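{- The $\mathbb{Q}$-linear map $\mathfrak{g}^{\mathrm{sh}}:\mathcal{I}^1_\bullet\to\mathbb{C}[[q]]$ is an algebra homomorphism, where $\mathcal{I}^1_\bullet$ carries the shuffle product.
   Context: Let $\mathcal{I}_\bullet$ be the $\mathbb{Q}$-vector space spanned by symbols $\mathbb{I}(a_0;a_1,\ldots,a_N;a_{N+1})$ ($N\ge 0$, $a_i\in\{0,1\}$) subject to: (I1) $\mathbb{I}(a;\emptyset;b)=1$; (I2) the product is the shuffle product: $\mathbb{I}(a_0;a_1,\ldots,a_N;a_{N+N'+1})\,\mathbb{I}(a_0;a_{N+1},\ldots,a_{N+N'};a_{N+N'+1})=\sum_{\sigma\in\Sigma(N,N')}\mathbb{I}(a_0;a_{\sigma^{ -1}(1)},\ldots,a_{\sigma^{ -1}(N+N')};a_{N+N'+1})$, $\Sigma(N,N')$ being the $\sigma\in\mathfrak{S}_{N+N'}$ with $\sigma(1)<\cdots<\sigma(N)$, $\sigma(N+1)<\cdots<\sigma(N+N')$; (I3) for $x\in\{0,1\}$, $\mathbb{I}(a_0;a_1,\ldots,a_N;a_{N+1})=\sum_{k=0}^N\mathbb{I}(a_0;a_1,\ldots,a_k;x)\mathbb{I}(x;a_{k+1},\ldots,a_N;a_{N+1})$; (I4) $\mathbb{I}(a;a_1,\ldots,a_N;a)=0$ for $N\ge1$. This is a commutative $\mathbb{Q}$-algebra. Let $\mathcal{I}^1_\bullet=\mathcal{I}_\bullet/\mathbb{I}(0;0;1)\mathcal{I}_\bullet$, $I(\cdots)$ the images, and $I(n_1,\ldots,n_r)=I(0;1,0^{n_1-1},\ldots,1,0^{n_r-1};1)$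 ($n_i\ge1$, $0^m$ = $m$ zeros), $I()=1$; these form a $\mathbb{Q}$-basis of $\mathcal{I}^1_\bullet$. For positive integers $n_i$ and variables $x_i$ let $H\binom{n_1,\ldots,n_r}{x_1,\ldots,x_r}=\sum_{0<u_1<\cdots<u_r}\prod_{j=1}^re^{u_jx_j}\big(\frac{q^{u_j}}{1-q^{u_j}}\big)^{n_j}\in\mathbb{Q}[[q]][[x_1,\ldots,x_r]]$. Let $h(x_1,\ldots,x_r)=\sum_{(i_1,\ldots,i_m)}\frac{1}{i_1!\cdots i_m!}H\binom{i_1,\ldots,i_m}{y_1,\ldots,y_m}$ over all compositions $i_1+\cdots+i_m=r$ ($i_j\ge1$), with $y_1=x_1+\cdots+x_{i_1}$, $y_2=x_{i_1+1}+\cdots+x_{i_1+i_2}$, ..., $y_m=x_{i_1+\cdots+i_{m-1}+1}+\cdots+x_r$. Let $g_{\mathrm{sh}}(x_1,\ldots,x_r)=h(x_r-x_{r-1},\ldots,x_2-x_1,x_1)$, and let $g^{\mathrm{sh}}_{n_1,\ldots,n_r}(q)$ be the coefficient of $x_1^{n_1-1}\cdots x_r^{n_r-1}$ in $g_{\mathrm{sh}}(-2\pi\sqrt{ -1}x_1,\ldots,-2\pi\sqrt{ -1}x_r)$. Define $\mathfrak{g}^{\mathrm{sh}}$ $\mathbb{Q}$-linearly by $\mathfrak{g}^{\mathrm{sh}}(I(n_1,\ldots,n_r))=g^{\mathrm{sh}}_{n_1,\ldots,n_r}(q)$ and $\mathfrak{g}^{\mathrm{sh}}(1)=1$. -}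

module Defs where

open import Data.Bool using (Bool; true; false; if_then_else_; _∧_)
open import Relation.Binary.PropositionalEquality using (_≡_)
open import Data.Nat as ℕ using (ℕ; zero; suc; _∸_; _≡ᵇ_; _<ᵇ_; _!)
open import Data.Nat.Properties using (_!≢0)
open import Data.Integer using (+_)
open import Data.List using (List; []; _∷_; map; foldr; concatMap; applyUpTo; upTo; replicate; length; _++_)
open import Data.Product using (_×_; _,_)
open import Data.Rational using (ℚ; 0ℚ; 1ℚ; _+_; _*_; _-_; _/_)

sumQ : List ℚ → ℚ
sumQ = foldr _+_ 0ℚ

prodQ : List ℚ → ℚ
prodQ = foldr _*_ 1ℚ

sumN : List ℕ → ℕ
sumN = foldr ℕ._+_ 0

nQ : ℕ → ℚ
nQ n = + n / 1

invFact : ℕ → ℚ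
invFact n = (+ 1 / (n !)) {{n !≢0}}

atQ : List ℚ → ℕ → ℚ
atQ []       _       = 0ℚ
atQ (x ∷ _)  zero    = x
atQ (_ ∷ xs) (suc i) = atQ xs i

atN : List ℕ → ℕ → ℕ
atN []       _       = 0
atN (x ∷ _)  zero    = x
atN (_ ∷ xs) (suc i) = atN xs i

decAt : List ℕ → ℕ → List ℕ
decAt []       _       = []
decAt (x ∷ xs) zero    = (x ∸ 1) ∷ xs
decAt (x ∷ xs) (suc i) = x ∷ decAt xs i

allZero : List ℕ → Bool
allZero []          = true
allZero (zero ∷ xs) = allZero xs
allZero (suc _ ∷ _) = false

zipWithL : {A B C : Set} → (A → B → C) → List A → List B → List C
zipWithL f []       _        = []
zipWithL f (_ ∷ _)  []       = []
zipWithL f (a ∷ as) (b ∷ bs) = f a b ∷ zipWithL f as bs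

-- Formal power series in q with rational coefficients: k ↦ [q^k]

Ser₁ : Set
Ser₁ = ℕ → ℚ

one₁ : Ser₁
one₁ k = if k ≡ᵇ 0 then 1ℚ else 0ℚ

mul₁ : Ser₁ → Ser₁ → Ser₁
mul₁ f g k = sumQ (map (λ i → f i * g (k ∸ i)) (upTo (suc k)))

pow₁ : Ser₁ → ℕ → Ser₁
pow₁ f zero    = one₁
pow₁ f (suc n) = mul₁ f (pow₁ f n)

-- q^u / (1 - q^u) = Σ_{m ≥ 1} q^{u m}   (used for u ≥ 1)
geom : ℕ → Ser₁
geom u k = sumQ (map (λ m → if (u ℕ.* suc m) ≡ᵇ k then 1ℚ else 0ℚ) (upTo k))

-- Multivariate series in x₁..x_m with coefficients in ℚ[[q]]:
-- (exponent vector a, q-degree k) ↦ [x^a q^k]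

MSer : Set
MSer = List ℕ → ℕ → ℚ

incs : ℕ → ℕ → ℕ → List (List ℕ)
incs zero    lo k = [] ∷ []
incs (suc m) lo k =
  concatMap (λ i → let u = suc (lo ℕ.+ i) in map (u ∷_) (incs m u k)) (upTo (k ∸ lo))

-- H(n₁..n_m ; x₁..x_m) = Σ_{0<u₁<⋯<u_m} Π_j e^{u_j x_j} (q^{u_j}/(1-q^{u_j}))^{n_j}.
-- [x^a q^k]: only u_m ≤ k contributes, since each factor q^{u}/(1-q^u) has
-- q-valuation u ≥ 1; [x^a] Π e^{u_j x_j} = Π u_j^{a_j}/a_j!.
Hcoef : List ℕ → MSer
Hcoef ns as k = sumQ (map term (incs (length ns) 0 k))
  where
  term : List ℕ → ℚ
  term us =
    prodQ (zipWithL (λ u a → nQ (u ℕ.^ a) * invFact a) us as)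
    * foldr mul₁ one₁ (zipWithL (λ u n → pow₁ (geom u) n) us ns) k

monos : ℕ → ℕ → List (List ℕ)
monos zero    zero    = [] ∷ []
monos zero    (suc d) = []
monos (suc m) d       = concatMap (λ i → map (i ∷_) (monos m (d ∸ i))) (upTo (suc d))

-- [x^a] of a product of linear forms (each form = list of coefficients of x₁..x_r)
coefLinProd : List (List ℚ) → List ℕ → ℚ
coefLinProd []       a = if allZero a then 1ℚ else 0ℚ
coefLinProd (L ∷ Ls) a =
  sumQ (map (λ p → if 0 <ᵇ atN a p then atQ L p * coefLinProd Ls (decAt a p) else 0ℚ)
            (upTo (length a)))

-- linear substitution: given f in m variables and m linear forms ℓ₁..ℓ_m in
-- r variables, [x^a] f(ℓ₁(x),…,ℓ_m(x)) = Σ_{|b|=|a|} f_b [x^a] Π ℓ_l^{b_l}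
substLin : MSer → ℕ → List (List ℚ) → MSer
substLin f m Ls a k =
  sumQ (map (λ b → f b k * coefLinProd (concat' (zipWithL replicate b Ls)) a)
            (monos m (sumN a)))
  where
  concat' : List (List (List ℚ)) → List (List ℚ)
  concat' = foldr _++_ []

compsF : ℕ → ℕ → List (List ℕ)
compsF zero    zero    = [] ∷ []
compsF zero    (suc n) = []
compsF (suc f) zero    = [] ∷ []
compsF (suc f) (suc n) = concatMap (λ i → map (suc i ∷_) (compsF f (n ∸ i))) (upTo (suc n))

comps : ℕ → List (List ℕ)
comps n = compsF n n

-- the linear forms y_j = z_{off+1} + ⋯ + z_{off+i_j} in r variables
blockForms : List ℕ → ℕ → ℕ → List (List ℚ)
blockForms []       off r = []
blockForms (c ∷ cs) off r =
  applyUpTo (λ p → if (p <ᵇ off) then 0ℚ else (if p <ᵇ (off ℕ.+ c) then 1ℚ else 0ℚ)) r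
  ∷ blockForms cs (off ℕ.+ c) r

-- h(z₁..z_r) = Σ_{i₁+⋯+i_m=r} (1/(i₁!⋯i_m!)) H(i₁..i_m ; y₁..y_m)
hcoef : ℕ → MSer
hcoef r b k =
  sumQ (map (λ is → prodQ (map invFact is)
                    * substLin (Hcoef is) (length is) (blockForms is 0 r) b k)
            (comps r))

-- g_sh(x₁..x_r) = h(x_r - x_{r-1}, …, x₂ - x₁, x₁):
-- the l-th argument (1-based) is x_{r+1-l} - x_{r-l}, with x₀ := 0
gshForms : ℕ → List (List ℚ)
gshForms r = applyUpTo (λ l' → form (suc l')) r
  where
  form : ℕ → List ℚ
  form l = applyUpTo (λ p' → let p = suc p' in
             (if (p ℕ.+ l) ≡ᵇ suc r then 1ℚ else 0ℚ) - (if (p ℕ.+ l) ≡ᵇ r then 1ℚ else 0ℚ)) r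

gshcoef : ℕ → MSer
gshcoef r = substLin (hcoef r) r (gshForms r)

-- Target: ℂ[[q]] is represented by ℚ[[q,t]] where t stands for -2π√-1
-- (q-degree k, t-degree j) ↦ coefficient.

Ser : Set
Ser = ℕ → ℕ → ℚ

_≈S_ : Ser → Ser → Set
f ≈S g = ∀ k j → f k j ≡ g k j

oneS : Ser
oneS k j = if (k ≡ᵇ 0) ∧ (j ≡ᵇ 0) then 1ℚ else 0ℚ

mulS : Ser → Ser → Ser
mulS f g k j =
  sumQ (concatMap (λ i → map (λ l → f i l * g (k ∸ i) (j ∸ l)) (upTo (suc j))) (upTo (suc k)))

-- The algebra 𝓘¹ with its basis I(n₁,…,n_r).
-- A basis index is a list (k₁,…,k_r) of naturals encoding n_j = k_j + 1,
-- i.e. I(n₁..n_r) = I(0; 1,0^{k₁},…,1,0^{k_r}; 1).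

Comp : Set
Comp = List ℕ

-- the word a₁…a_N (true = 1, false = 0)
toWord : Comp → List Bool
toWord []       = []
toWord (k ∷ ks) = true ∷ (replicate k false ++ toWord ks)

-- inverse of toWord on words that are empty or start with 1
-- (shuffles of such words are again of this form)
mutual
  fromWord : List Bool → Comp
  fromWord []          = []
  fromWord (true ∷ w)  = block 0 w
  fromWord (false ∷ w) = fromWord w

  block : ℕ → List Bool → Comp
  block c []          = c ∷ []
  block c (false ∷ w) = block (suc c) w
  block c (true ∷ w)  = c ∷ block 0 w

-- shuffle of words, with multiplicity (= sum over σ ∈ Σ(N,N'))
shuffle : List Bool → List Bool → List (List Bool)
shuffle []       v        = v ∷ []
shuffle (a ∷ u)  []       = (a ∷ u) ∷ []
shuffle (a ∷ u)  (b ∷ v)  = map (a ∷_) (shuffle u (b ∷ v)) ++ map (b ∷_) (shuffle (a ∷ u) v)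

-- elements of 𝓘¹ as finite ℚ-linear combinations of basis elements
𝓘¹ : Set
𝓘¹ = List (ℚ × Comp)

unitI : 𝓘¹
unitI = (1ℚ , []) ∷ []

_·I_ : 𝓘¹ → 𝓘¹ → 𝓘¹
A ·I B = concatMap (λ { (c , w) → concatMap (λ { (d , v) →
           map (λ s → (c * d , fromWord s)) (shuffle (toWord w) (toWord v)) }) B }) A

-- 𝔤ˢʰ on basis elements:  g^{sh}_{n₁..n_r}(q) = (-2π√-1)^{Σ(n_j-1)} [x^{n-1}] g_sh(x),
-- i.e. t^{Σ k_j} · [x₁^{k₁}⋯x_r^{k_r}] g_sh ;  𝔤ˢʰ(1) = 1
gBasis : Comp → Ser
gBasis []       = oneS
gBasis (k ∷ ks) q j =
  if j ≡ᵇ sumN (k ∷ ks) then gshcoef (length (k ∷ ks)) (k ∷ ks) q else 0ℚ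

𝔤ˢʰ : 𝓘¹ → Ser
𝔤ˢʰ A q j = sumQ (map (λ { (c , w) → c * gBasis w q j }) A)

{-# OPTIONS --safe #-}
module Submission where

-- Expanding the products and substitutions, the coefficient of x^a in g_sh is
--   Σ ∏ᵤ gᵤ^{mᵤ}/mᵤ! · ∏ₚ (u_{r+1-p} − u_{r-p})^{aₚ}/aₚ!,   gᵤ = q^u/(1 − q^u),
-- over 0 = u₀ < u₁ ≤ ⋯ ≤ u_r, where mᵤ is the multiplicity of u.  This is the coefficient
-- of the word 1 0^{a₁} ⋯ 1 0^{a_r} in ⋯ exp(g₂ e₁) exp(e₀) exp(g₁ e₁) exp(e₀).  The
-- exponentials are grouplike, so each truncated product is a shuffle character, and since
-- gᵤ has q-valuation u, the first k steps determine the coefficient of q^k.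

open import Algebra.Bundles using (CommutativeRing)
open import Data.Bool using (Bool; true; false; _≟_; if_then_else_)
open import Data.List using (List; []; _∷_; _++_; length; replicate; map; reverse; foldr; [_])
open import Data.List.Properties using (length-replicate; length-++; ++-identityʳ; ++-assoc; reverse-++; unfold-reverse)
open import Data.Nat as ℕ using (ℕ; zero; suc)
import Data.Nat.Properties as ℕₚ
open import Data.Product using (_,_)
open import Relation.Nullary using (yes; no; does)
open import Relation.Binary.PropositionalEquality as ≡ using (_≡_)
import Relation.Binary.Reasoning.Setoid
open import Algebra.Solver.Ring.NaturalCoefficients.Default as Solver using ()
open import Defs using (shuffle; toWord; sumN; allZero; zipWithL)
open import Data.List.Relation.Unary.All as All using (All; []; _∷_)
import Data.List.Relation.Unary.All.Properties as All
open import Level using (0ℓ)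

-- The word coefficient is the stated sum for the following reason. The letters 1 sit at the points
-- u_r ≥ ⋯ ≥ u₁. A point u used m times gives gᵤ^m/m! from exp(gᵤ e₁). A run of a zeros between
-- neighbouring points at distance d gives d^a/a!, because the d factors exp(e₀) between them
-- multiply to exp(d e₀). Coinciding points have distance 0, which forces a = 0.
--
-- The products stabilise only on words without a leading 0: the word 0 itself takes the value n at
-- the n-th product. Multiplicativity is therefore proved for each finite product on all words, and
-- only then restricted to words that are empty or start with 1.
--
-- Exponentials never occur as infinite series. Their laws are proved on the terms xⁿ/n!: multiply
-- by n + 1, apply a Leibniz or Euler rule (`conv-euler`), cancel. The ring is kept abstract, with
-- the positive integers invertible, because these arguments serve twice: over ℚ for the
-- substitution of linear forms, and over ℚ[[q]] for the characters.

headOr0 : List ℕ → ℕ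
headOr0 []      = 0
headOr0 (x ∷ _) = x

-- Sums over i + j = n

module Convolution {c ℓ} (R : CommutativeRing c ℓ) where
  open CommutativeRing R hiding (zero)
  open Relation.Binary.Reasoning.Setoid setoid
  open Solver commutativeSemiring using (solve; _:=_; _:+_; _:*_)

  nat : ℕ → Carrier
  nat zero    = 0#
  nat (suc n) = 1# + nat n

  -- The index is shifted, `inv n` being 1/(n + 1), so that no side condition n ≠ 0 is carried
  -- around.
  InvertsNats : (ℕ → Carrier) → Set ℓ
  InvertsNats inv = ∀ n → nat (suc n) * inv n ≈ 1#

  -- Both indices of i + j = n are handed to the summand, which avoids truncated subtraction and
  -- makes the sum structurally recursive.
  conv : ℕ → (ℕ → ℕ → Carrier) → Carrier
  conv zero    F = F 0 0
  conv (suc n) F = F 0 (suc n) + conv n (λ i j → F (suc i) j)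

  conv-cong : ∀ n {F G : ℕ → ℕ → Carrier} →
              (∀ i j → i ℕ.+ j ≡ n → F i j ≈ G i j) → conv n F ≈ conv n G
  conv-cong zero    h = h 0 0 ≡.refl
  conv-cong (suc n) h =
    +-cong (h 0 (suc n) ≡.refl) (conv-cong n λ i j e → h (suc i) j (≡.cong suc e))

  conv-0 : ∀ n → conv n (λ _ _ → 0#) ≈ 0#
  conv-0 zero    = refl
  conv-0 (suc n) = trans (+-identityˡ _) (conv-0 n)

  conv-zero : ∀ n {F : ℕ → ℕ → Carrier} →
              (∀ i j → i ℕ.+ j ≡ n → F i j ≈ 0#) → conv n F ≈ 0#
  conv-zero n h = trans (conv-cong n h) (conv-0 n)

  conv-+ : ∀ n (F G : ℕ → ℕ → Carrier) →
           conv n (λ i j → F i j + G i j) ≈ conv n F + conv n G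
  conv-+ zero    F G = refl
  conv-+ (suc n) F G = begin
    (F 0 (suc n) + G 0 (suc n)) + conv n (λ i j → F (suc i) j + G (suc i) j)
      ≈⟨ +-congˡ (conv-+ n _ _) ⟩
    (F 0 (suc n) + G 0 (suc n)) + (conv n (λ i j → F (suc i) j) + conv n (λ i j → G (suc i) j))
      ≈⟨ solve 4 (λ a b x y → (a :+ b) :+ (x :+ y) := (a :+ x) :+ (b :+ y)) refl _ _ _ _ ⟩
    conv (suc n) F + conv (suc n) G ∎

  conv-*ˡ : ∀ n x (F : ℕ → ℕ → Carrier) → conv n (λ i j → x * F i j) ≈ x * conv n F
  conv-*ˡ zero    x F = refl
  conv-*ˡ (suc n) x F = trans (+-congˡ (conv-*ˡ n x _)) (sym (distribˡ x _ _))

  conv-*ʳ : ∀ n x (F : ℕ → ℕ → Carrier) → conv n (λ i j → F i j * x) ≈ conv n F * x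
  conv-*ʳ zero    x F = refl
  conv-*ʳ (suc n) x F = trans (+-congˡ (conv-*ʳ n x _)) (sym (distribʳ x _ _))

  conv-last : ∀ n (F : ℕ → ℕ → Carrier) →
              conv (suc n) F ≈ conv n (λ i j → F i (suc j)) + F (suc n) 0
  conv-last zero    F = refl
  conv-last (suc n) F = trans (+-congˡ (conv-last n λ i j → F (suc i) j)) (sym (+-assoc _ _ _))

  conv-comm : ∀ n (F : ℕ → ℕ → Carrier) → conv n F ≈ conv n (λ i j → F j i)
  conv-comm zero    F = refl
  conv-comm (suc n) F = begin
    F 0 (suc n) + conv n (λ i j → F (suc i) j) ≈⟨ +-congˡ (conv-comm n _) ⟩
    F 0 (suc n) + conv n (λ i j → F (suc j) i) ≈⟨ +-comm _ _ ⟩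
    conv n (λ i j → F (suc j) i) + F 0 (suc n) ≈⟨ conv-last n (λ i j → F j i) ⟨
    conv (suc n) (λ i j → F j i) ∎

  -- Both sides run over the triples with i + k + l = n.
  conv-assoc : ∀ n (F : ℕ → ℕ → ℕ → Carrier) →
               conv n (λ m l → conv m (λ i k → F i k l)) ≈
               conv n (λ i m → conv m (λ k l → F i k l))
  conv-assoc zero    F = refl
  conv-assoc (suc n) F = begin
    F 0 0 (suc n) + conv n (λ m l → F 0 (suc m) l + conv m (λ i k → F (suc i) k l))
      ≈⟨ +-congˡ (conv-+ n _ _) ⟩
    F 0 0 (suc n) + (conv n (λ m l → F 0 (suc m) l) + conv n (λ m l → conv m (λ i k → F (suc i) k l)))
      ≈⟨ +-congˡ (+-congˡ (conv-assoc n _)) ⟩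
    F 0 0 (suc n) + (conv n (λ m l → F 0 (suc m) l) + conv n (λ i m → conv m (λ k l → F (suc i) k l)))
      ≈⟨ +-assoc _ _ _ ⟨
    conv (suc n) (λ i m → conv m (λ k l → F i k l)) ∎

  conv-swap : ∀ n (F : ℕ → ℕ → ℕ → Carrier) →
              conv n (λ i m → conv m (λ k l → F i k l)) ≈
              conv n (λ k m → conv m (λ i l → F i k l))
  conv-swap n F = begin
    conv n (λ i m → conv m (λ k l → F i k l)) ≈⟨ conv-assoc n F ⟨
    conv n (λ m l → conv m (λ i k → F i k l)) ≈⟨ conv-cong n (λ m l _ → conv-comm m _) ⟩
    conv n (λ m l → conv m (λ k i → F i k l)) ≈⟨ conv-assoc n (λ k i l → F i k l) ⟩
    conv n (λ k m → conv m (λ i l → F i k l)) ∎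

  nat-+ : ∀ m n → nat (m ℕ.+ n) ≈ nat m + nat n
  nat-+ zero    n = sym (+-identityˡ _)
  nat-+ (suc m) n = trans (+-congˡ (nat-+ m n)) (sym (+-assoc _ _ _))

  -- On terms with i + j = n + 1 the weights i and j add up to n + 1; the terms of weight 0 drop
  -- out, which causes the shift of indices. Together with `nat-cancel` this is the engine behind
  -- `dp-+`, `pair-P` and `ex-addMul`.
  conv-euler : ∀ n (F : ℕ → ℕ → Carrier) →
               conv n (λ i j → nat (suc i) * F (suc i) j) +
               conv n (λ i j → nat (suc j) * F i (suc j)) ≈
               nat (suc n) * conv (suc n) F
  conv-euler n F = begin
    conv n (λ i j → nat (suc i) * F (suc i) j) + conv n (λ i j → nat (suc j) * F i (suc j))
      ≈⟨ +-cong (trans (+-congʳ (zeroˡ _)) (+-identityˡ _)) (trans (+-congˡ (zeroˡ _)) (+-identityʳ _)) ⟨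
    conv (suc n) (λ i j → nat i * F i j) + (conv n (λ i j → nat (suc j) * F i (suc j)) + 0# * F (suc n) 0)
      ≈⟨ +-congˡ (conv-last n (λ i j → nat j * F i j)) ⟨
    conv (suc n) (λ i j → nat i * F i j) + conv (suc n) (λ i j → nat j * F i j)
      ≈⟨ conv-+ (suc n) (λ i j → nat i * F i j) (λ i j → nat j * F i j) ⟨
    conv (suc n) (λ i j → nat i * F i j + nat j * F i j)
      ≈⟨ conv-cong (suc n) (λ i j e → trans (sym (distribʳ (F i j) (nat i) (nat j)))
           (*-congʳ (trans (sym (nat-+ i j)) (reflexive (≡.cong nat e))))) ⟩
    conv (suc n) (λ i j → nat (suc n) * F i j)
      ≈⟨ conv-*ˡ (suc n) _ F ⟩
    nat (suc n) * conv (suc n) F ∎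

  sum≤ : ℕ → (ℕ → Carrier) → Carrier
  sum≤ n f = conv n (λ i _ → f i)

  sum≤-stable : ∀ n d (f : ℕ → Carrier) → (∀ i → n ℕ.< i → f i ≈ 0#) →
                sum≤ (d ℕ.+ n) f ≈ sum≤ n f
  sum≤-stable n zero    f h = refl
  sum≤-stable n (suc d) f h = begin
    sum≤ (suc d ℕ.+ n) f               ≈⟨ conv-last (d ℕ.+ n) (λ i _ → f i) ⟩
    sum≤ (d ℕ.+ n) f + f (suc d ℕ.+ n) ≈⟨ +-cong (sum≤-stable n d f h) (h _ (ℕ.s≤s (ℕₚ.m≤n+m n d))) ⟩
    sum≤ n f + 0#                      ≈⟨ +-identityʳ _ ⟩
    sum≤ n f ∎

  -- The rectangle i ≤ m, j ≤ n lies inside the triangle i + j ≤ m + n, and the rest of the triangle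
  -- contributes nothing: for i ≤ m the remaining range k = m + n - i is at least n, and for i > m
  -- the factor `f i` vanishes.
  sum≤-* : ∀ m n (f g : ℕ → Carrier) →
           (∀ i → m ℕ.< i → f i ≈ 0#) → (∀ i → n ℕ.< i → g i ≈ 0#) →
           sum≤ m f * sum≤ n g ≈ sum≤ (m ℕ.+ n) (λ k → conv k (λ i j → f i * g j))
  sum≤-* m n f g hf hg = begin
    sum≤ m f * sum≤ n g
      ≈⟨ *-congʳ (sum≤-stable m n f hf) ⟨
    sum≤ (n ℕ.+ m) f * sum≤ n g
      ≈⟨ *-congʳ (reflexive (≡.cong (λ N → sum≤ N f) (ℕₚ.+-comm n m))) ⟩
    sum≤ (m ℕ.+ n) f * sum≤ n g
      ≈⟨ conv-*ʳ (m ℕ.+ n) _ _ ⟨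
    conv (m ℕ.+ n) (λ i _ → f i * sum≤ n g)
      ≈⟨ conv-cong (m ℕ.+ n) term ⟩
    conv (m ℕ.+ n) (λ i k → f i * sum≤ k g)
      ≈⟨ conv-cong (m ℕ.+ n) (λ i k _ → conv-*ˡ k (f i) _) ⟨
    conv (m ℕ.+ n) (λ i k → conv k (λ j _ → f i * g j))
      ≈⟨ conv-assoc (m ℕ.+ n) _ ⟨
    sum≤ (m ℕ.+ n) (λ k → conv k (λ i j → f i * g j)) ∎
    where
    term : ∀ i k → i ℕ.+ k ≡ m ℕ.+ n → f i * sum≤ n g ≈ f i * sum≤ k g
    term i k e with i ℕₚ.≤? m
    ... | yes i≤m = *-congˡ (sym (trans (reflexive (≡.cong (λ N → sum≤ N g) (≡.sym (ℕₚ.m∸n+n≡m n≤k)))) (sum≤-stable n (k ℕ.∸ n) g hg)))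
      where
      n≤k : n ℕ.≤ k
      n≤k = ℕₚ.+-cancelˡ-≤ m n k (≡.subst (ℕ._≤ m ℕ.+ k) e (ℕₚ.+-monoˡ-≤ k i≤m))
    ... | no i≰m = trans (*-congʳ fi≈0) (trans (zeroˡ _) (sym (trans (*-congʳ fi≈0) (zeroˡ _))))
      where
      fi≈0 : f i ≈ 0#
      fi≈0 = hf i (ℕₚ.≰⇒> i≰m)

  -- Gaps of a decreasing sequence; the default of `headOr0` supplies the endpoint u₀ = 0 of the
  -- last gap.
  diffs : List ℕ → List Carrier
  diffs []       = []
  diffs (x ∷ xs) = (nat x - nat (headOr0 xs)) ∷ diffs xs

-- Divided powers xⁿ/n!

module DividedPowers {c ℓ} (R : CommutativeRing c ℓ)
  (inv : ℕ → CommutativeRing.Carrier R) (inv-inverse : Convolution.InvertsNats R inv) where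

  open CommutativeRing R hiding (zero)
  open Convolution R
  open Relation.Binary.Reasoning.Setoid setoid
  open Solver commutativeSemiring using (solve; _:=_; _:+_; _:*_)

  nat-cancel : ∀ n {x y} → nat (suc n) * x ≈ nat (suc n) * y → x ≈ y
  nat-cancel n {x} {y} e = trans (sym (lem x)) (trans (*-congˡ e) (lem y))
    where
    lem : ∀ z → inv n * (nat (suc n) * z) ≈ z
    lem z = begin
      inv n * (nat (suc n) * z) ≈⟨ solve 3 (λ a b z → a :* (b :* z) := (b :* a) :* z) refl (inv n) _ z ⟩
      nat (suc n) * inv n * z   ≈⟨ *-congʳ (inv-inverse n) ⟩
      1# * z                    ≈⟨ *-identityˡ z ⟩
      z ∎

  -- dp x n = xⁿ/n!
  dp : Carrier → ℕ → Carrier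
  dp x zero    = 1#
  dp x (suc n) = inv n * (x * dp x n)

  dp-suc : ∀ x n → nat (suc n) * dp x (suc n) ≈ x * dp x n
  dp-suc x n = begin
    nat (suc n) * (inv n * (x * dp x n)) ≈⟨ *-assoc _ _ _ ⟨
    nat (suc n) * inv n * (x * dp x n)   ≈⟨ *-congʳ (inv-inverse n) ⟩
    1# * (x * dp x n)                    ≈⟨ *-identityˡ _ ⟩
    x * dp x n ∎

  dp-cong : ∀ {x y} n → x ≈ y → dp x n ≈ dp y n
  dp-cong zero    e = refl
  dp-cong (suc n) e = *-congˡ (*-cong e (dp-cong n e))

  dp-0 : ∀ n → dp 0# (suc n) ≈ 0#
  dp-0 n = trans (*-congˡ (zeroˡ _)) (zeroʳ _)

  -- The binomial theorem for divided powers. Multiplication by n + 1 acts like differentiation: the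
  -- left side yields the factor x + y, and on the right the Leibniz rule `conv-euler` yields x and
  -- y separately.
  dp-+ : ∀ x y n → dp (x + y) n ≈ conv n (λ i j → dp x i * dp y j)
  dp-+ x y zero    = sym (*-identityˡ _)
  dp-+ x y (suc n) = nat-cancel n (begin
    nat (suc n) * dp (x + y) (suc n)
      ≈⟨ dp-suc (x + y) n ⟩
    (x + y) * dp (x + y) n
      ≈⟨ *-congˡ (dp-+ x y n) ⟩
    (x + y) * conv n (λ i j → dp x i * dp y j)
      ≈⟨ distribʳ _ x y ⟩
    x * conv n (λ i j → dp x i * dp y j) + y * conv n (λ i j → dp x i * dp y j)
      ≈⟨ +-cong (conv-*ˡ n x _) (conv-*ˡ n y _) ⟨
    conv n (λ i j → x * (dp x i * dp y j)) + conv n (λ i j → y * (dp x i * dp y j))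
      ≈⟨ +-cong (conv-cong n λ i j _ → trans (sym (*-assoc _ _ _)) (trans (*-congʳ (sym (dp-suc x i))) (*-assoc _ _ _)))
                (conv-cong n λ i j _ → trans (solve 3 (λ y a b → y :* (a :* b) := (y :* b) :* a) refl y _ _)
                  (trans (*-congʳ (sym (dp-suc y j))) (solve 3 (λ m b a → (m :* b) :* a := m :* (a :* b)) refl (nat (suc j)) _ _))) ⟩
    conv n (λ i j → nat (suc i) * (dp x (suc i) * dp y j)) + conv n (λ i j → nat (suc j) * (dp x i * dp y (suc j)))
      ≈⟨ conv-euler n (λ i j → dp x i * dp y j) ⟩
    nat (suc n) * conv (suc n) (λ i j → dp x i * dp y j) ∎)

  -- ex x a is the coefficient of yᵃ in e^{x·y}
  ex : List Carrier → List ℕ → Carrier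
  ex []       _        = 1#
  ex (_ ∷ _)  []       = 1#
  ex (x ∷ xs) (a ∷ as) = dp x a * ex xs as

-- Shuffle characters and multiplication by the exponential of a letter

shuffle-length : ∀ u v → All (λ s → length s ≡ length u ℕ.+ length v) (shuffle u v)
shuffle-length []      v       = ≡.refl ∷ []
shuffle-length (a ∷ u) []      = ≡.cong suc (≡.sym (ℕₚ.+-identityʳ _)) ∷ []
shuffle-length (a ∷ u) (b ∷ v) = All.++⁺
  (All.map⁺ (All.map (≡.cong suc) (shuffle-length u (b ∷ v))))
  (All.map⁺ (All.map (λ e → ≡.trans (≡.cong suc e) (≡.cong suc (≡.sym (ℕₚ.+-suc _ _)))) (shuffle-length (a ∷ u) v)))

module ShuffleCharacters {c ℓ} (R : CommutativeRing c ℓ)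
  (inv : ℕ → CommutativeRing.Carrier R) (inv-inverse : Convolution.InvertsNats R inv) where

  open CommutativeRing R hiding (zero)
  open Convolution R
  open DividedPowers R inv inv-inverse
  open Relation.Binary.Reasoning.Setoid setoid
  open Solver commutativeSemiring using (solve; _:=_; _:+_; _:*_)

  when : Bool → Carrier → Carrier
  when true  x = x
  when false _ = 0#

  when-cong : ∀ b {x y} → x ≈ y → when b x ≈ when b y
  when-cong true  e = e
  when-cong false _ = refl

  when-* : ∀ b x y → when b (x * y) ≈ x * when b y
  when-* true  x y = refl
  when-* false x y = sym (zeroʳ x)

  Word : Set
  Word = List Bool

  -- If `f` is read as the noncommutative series Σ f(w) w, this is multiplication by the letter `a`
  -- from the left.
  ∂ : Bool → (Word → Carrier) → Word → Carrier
  ∂ a f []      = 0#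
  ∂ a f (b ∷ w) = when (does (a ≟ b)) (f w)

  ∂-cong : ∀ a {f g : Word → Carrier} → (∀ w → f w ≈ g w) → ∀ w → ∂ a f w ≈ ∂ a g w
  ∂-cong a h []      = refl
  ∂-cong a h (b ∷ w) = when-cong (does (a ≟ b)) (h w)

  ∂-*ˡ : ∀ a x (f : Word → Carrier) w → ∂ a (λ w → x * f w) w ≈ x * ∂ a f w
  ∂-*ˡ a x f []      = sym (zeroʳ x)
  ∂-*ˡ a x f (b ∷ w) = when-* (does (a ≟ b)) x (f w)

  ∂-conv : ∀ a n (F : ℕ → ℕ → Word → Carrier) w →
           ∂ a (λ w → conv n (λ i j → F i j w)) w ≈ conv n (λ i j → ∂ a (F i j) w)
  ∂-conv a n F []      = sym (conv-0 n)
  ∂-conv a n F (b ∷ w) with does (a ≟ b)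
  ... | true  = refl
  ... | false = sym (conv-0 n)

  sumL : ∀ {a} {A : Set a} → (A → Carrier) → List A → Carrier
  sumL f = foldr (λ s t → f s + t) 0#

  sumL-cong : ∀ {a} {A : Set a} {f g : A → Carrier} (xs : List A) → (∀ x → f x ≈ g x) → sumL f xs ≈ sumL g xs
  sumL-cong []       h = refl
  sumL-cong (x ∷ xs) h = +-cong (h x) (sumL-cong xs h)

  sumL-congᴬ : ∀ {a} {A : Set a} {f g : A → Carrier} {xs : List A} → All (λ x → f x ≈ g x) xs → sumL f xs ≈ sumL g xs
  sumL-congᴬ []      = refl
  sumL-congᴬ (h ∷ hs) = +-cong h (sumL-congᴬ hs)

  sumL-++ : ∀ {a} {A : Set a} (f : A → Carrier) xs ys → sumL f (xs ++ ys) ≈ sumL f xs + sumL f ys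
  sumL-++ f []       ys = sym (+-identityˡ _)
  sumL-++ f (x ∷ xs) ys = trans (+-congˡ (sumL-++ f xs ys)) (sym (+-assoc _ _ _))

  sumL-map : ∀ {a b} {A : Set a} {B : Set b} (f : B → Carrier) (g : A → B) xs → sumL f (map g xs) ≈ sumL (λ x → f (g x)) xs
  sumL-map f g []       = refl
  sumL-map f g (x ∷ xs) = +-congˡ (sumL-map f g xs)

  sumL-*ˡ : ∀ {a} {A : Set a} x (f : A → Carrier) xs → sumL (λ s → x * f s) xs ≈ x * sumL f xs
  sumL-*ˡ x f []       = sym (zeroʳ x)
  sumL-*ˡ x f (y ∷ xs) = trans (+-congˡ (sumL-*ˡ x f xs)) (sym (distribˡ x _ _))

  sumL-when : ∀ b (f : Word → Carrier) xs → sumL (λ s → when b (f s)) xs ≈ when b (sumL f xs)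
  sumL-when true  f xs = refl
  sumL-when false f []       = refl
  sumL-when false f (x ∷ xs) = trans (+-identityˡ _) (sumL-when false f xs)

  sumL-conv : ∀ {a} {A : Set a} n (F : ℕ → ℕ → A → Carrier) xs →
              sumL (λ s → conv n (λ i j → F i j s)) xs ≈ conv n (λ i j → sumL (F i j) xs)
  sumL-conv n F []       = sym (conv-0 n)
  sumL-conv n F (x ∷ xs) = trans (+-congˡ (sumL-conv n F xs)) (sym (conv-+ n _ _))

  pair : (Word → Carrier) → Word → Word → Carrier
  pair f u v = sumL f (shuffle u v)

  pair-∷∷ : ∀ f x u y v →
            pair f (x ∷ u) (y ∷ v) ≈
            pair (λ s → f (x ∷ s)) u (y ∷ v) + pair (λ s → f (y ∷ s)) (x ∷ u) v
  pair-∷∷ f x u y v = trans (sumL-++ f (map (x ∷_) (shuffle u (y ∷ v))) _)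
    (+-cong (sumL-map f (x ∷_) (shuffle u (y ∷ v))) (sumL-map f (y ∷_) (shuffle (x ∷ u) v)))

  pair-[]ʳ : ∀ f u → pair f u [] ≈ f u
  pair-[]ʳ f []      = +-identityʳ _
  pair-[]ʳ f (_ ∷ _) = +-identityʳ _

  -- The first letter of a shuffle is the first letter of `u` or that of `v`. In other words, a
  -- letter is primitive for the coproduct dual to the shuffle product.
  pair-∂ : ∀ a f u v →
           pair (∂ a f) u v ≈ ∂ a (λ u′ → pair f u′ v) u + ∂ a (λ v′ → pair f u v′) v
  pair-∂ a f []      v  = begin
    ∂ a f v + 0#                     ≈⟨ +-comm _ _ ⟩
    0# + ∂ a f v                     ≈⟨ +-congˡ (∂-cong a (λ w → +-identityʳ (f w)) v) ⟨
    0# + ∂ a (λ v′ → pair f [] v′) v ∎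
  pair-∂ a f (x ∷ u) [] = +-congʳ (when-cong (does (a ≟ x)) (sym (pair-[]ʳ f u)))
  pair-∂ a f (x ∷ u) (y ∷ v) = trans (pair-∷∷ (∂ a f) x u y v)
    (+-cong (sumL-when (does (a ≟ x)) f (shuffle u (y ∷ v))) (sumL-when (does (a ≟ y)) f (shuffle (x ∷ u) v)))

  ∂^ : Bool → ℕ → (Word → Carrier) → Word → Carrier
  ∂^ a zero    f = f
  ∂^ a (suc n) f = ∂ a (∂^ a n f)

  ∂^-cong : ∀ a n {f g : Word → Carrier} → (∀ w → f w ≈ g w) → ∀ w → ∂^ a n f w ≈ ∂^ a n g w
  ∂^-cong a zero    h = h
  ∂^-cong a (suc n) h = ∂-cong a (∂^-cong a n h)

  ∂^-long : ∀ a n f w → length w ℕ.< n → ∂^ a n f w ≈ 0#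
  ∂^-long a (suc n) f []      _ = refl
  ∂^-long a (suc n) f (b ∷ w) (ℕ.s≤s l) = trans (when-cong (does (a ≟ b)) (∂^-long a n f w l)) (lem (does (a ≟ b)))
    where
    lem : ∀ b → when b 0# ≈ 0#
    lem true  = refl
    lem false = refl

  P : Bool → Carrier → ℕ → (Word → Carrier) → Word → Carrier
  P a x n f w = dp x n * ∂^ a n f w

  -- convolution, from the left, of f with the exponential character exp(x a) of the letter a
  E : Bool → Carrier → (Word → Carrier) → Word → Carrier
  E a x f w = sum≤ (length w) (λ n → P a x n f w)

  E-cong : ∀ a {x y} {f g : Word → Carrier} → x ≈ y → (∀ w → f w ≈ g w) → ∀ w → E a x f w ≈ E a y g w
  E-cong a e h w = conv-cong (length w) λ i _ _ → *-cong (dp-cong i e) (∂^-cong a i h w)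

  P-suc : ∀ a x n f w → nat (suc n) * P a x (suc n) f w ≈ x * ∂ a (P a x n f) w
  P-suc a x n f w = begin
    nat (suc n) * (dp x (suc n) * ∂^ a (suc n) f w) ≈⟨ *-assoc _ _ _ ⟨
    nat (suc n) * dp x (suc n) * ∂^ a (suc n) f w   ≈⟨ *-congʳ (dp-suc x n) ⟩
    x * dp x n * ∂^ a (suc n) f w                   ≈⟨ *-assoc _ _ _ ⟩
    x * (dp x n * ∂ a (∂^ a n f) w)                 ≈⟨ *-congˡ (∂-*ˡ a (dp x n) (∂^ a n f) w) ⟨
    x * ∂ a (P a x n f) w ∎

  IsCharacter : (Word → Carrier) → Set ℓ
  IsCharacter f = ∀ u v → pair f u v ≈ f u * f v

  module _ (a : Bool) (x : Carrier) (f : Word → Carrier) (char : IsCharacter f) where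

    private
      p : ℕ → Word → Carrier
      p n = P a x n f

    -- The coproduct of (x a)ⁿ/n! times a grouplike series, with `a` primitive. After multiplication
    -- by n + 1 one letter is split off by `pair-∂`, landing in `u` or in `v`, and `conv-euler`
    -- reassembles the two halves.
    pair-P : ∀ n u v → pair (p n) u v ≈ conv n (λ i j → p i u * p j v)
    pair-P zero    u v = begin
      pair (p 0) u v          ≈⟨ sumL-cong (shuffle u v) (λ s → *-identityˡ (f s)) ⟩
      pair f u v              ≈⟨ char u v ⟩
      f u * f v               ≈⟨ *-cong (*-identityˡ _) (*-identityˡ _) ⟨
      p 0 u * p 0 v ∎
    pair-P (suc n) u v = nat-cancel n (begin
      nat (suc n) * pair (p (suc n)) u v
        ≈⟨ sumL-*ˡ (nat (suc n)) (p (suc n)) (shuffle u v) ⟨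
      pair (λ s → nat (suc n) * p (suc n) s) u v
        ≈⟨ sumL-cong (shuffle u v) (P-suc a x n f) ⟩
      pair (λ s → x * ∂ a (p n) s) u v
        ≈⟨ sumL-*ˡ x (∂ a (p n)) (shuffle u v) ⟩
      x * pair (∂ a (p n)) u v
        ≈⟨ *-congˡ (pair-∂ a (p n) u v) ⟩
      x * (∂ a (λ u′ → pair (p n) u′ v) u + ∂ a (λ v′ → pair (p n) u v′) v)
        ≈⟨ distribˡ x _ _ ⟩
      x * ∂ a (λ u′ → pair (p n) u′ v) u + x * ∂ a (λ v′ → pair (p n) u v′) v
        ≈⟨ +-cong left right ⟩
      conv n (λ i j → nat (suc i) * (p (suc i) u * p j v)) + conv n (λ i j → nat (suc j) * (p i u * p (suc j) v))
        ≈⟨ conv-euler n (λ i j → p i u * p j v) ⟩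
      nat (suc n) * conv (suc n) (λ i j → p i u * p j v) ∎)
      where
      left : x * ∂ a (λ u′ → pair (p n) u′ v) u ≈ conv n (λ i j → nat (suc i) * (p (suc i) u * p j v))
      left = begin
        x * ∂ a (λ u′ → pair (p n) u′ v) u
          ≈⟨ *-congˡ (∂-cong a (λ u′ → trans (pair-P n u′ v) (conv-cong n λ i j _ → *-comm (p i u′) (p j v))) u) ⟩
        x * ∂ a (λ u′ → conv n (λ i j → p j v * p i u′)) u
          ≈⟨ *-congˡ (∂-conv a n (λ i j u′ → p j v * p i u′) u) ⟩
        x * conv n (λ i j → ∂ a (λ u′ → p j v * p i u′) u)
          ≈⟨ conv-*ˡ n x _ ⟨
        conv n (λ i j → x * ∂ a (λ u′ → p j v * p i u′) u)
          ≈⟨ conv-cong n (λ i j _ → begin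
             x * ∂ a (λ u′ → p j v * p i u′) u   ≈⟨ *-congˡ (∂-*ˡ a (p j v) (p i) u) ⟩
             x * (p j v * ∂ a (p i) u)           ≈⟨ solve 3 (λ x a b → x :* (a :* b) := (x :* b) :* a) refl x (p j v) _ ⟩
             x * ∂ a (p i) u * p j v             ≈⟨ *-congʳ (P-suc a x i f u) ⟨
             nat (suc i) * p (suc i) u * p j v   ≈⟨ *-assoc _ _ _ ⟩
             nat (suc i) * (p (suc i) u * p j v) ∎) ⟩
        conv n (λ i j → nat (suc i) * (p (suc i) u * p j v)) ∎
      right : x * ∂ a (λ v′ → pair (p n) u v′) v ≈ conv n (λ i j → nat (suc j) * (p i u * p (suc j) v))
      right = begin
        x * ∂ a (λ v′ → pair (p n) u v′) v
          ≈⟨ *-congˡ (∂-cong a (λ v′ → pair-P n u v′) v) ⟩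
        x * ∂ a (λ v′ → conv n (λ i j → p i u * p j v′)) v
          ≈⟨ *-congˡ (∂-conv a n (λ i j v′ → p i u * p j v′) v) ⟩
        x * conv n (λ i j → ∂ a (λ v′ → p i u * p j v′) v)
          ≈⟨ conv-*ˡ n x _ ⟨
        conv n (λ i j → x * ∂ a (λ v′ → p i u * p j v′) v)
          ≈⟨ conv-cong n (λ i j _ → begin
             x * ∂ a (λ v′ → p i u * p j v′) v   ≈⟨ *-congˡ (∂-*ˡ a (p i u) (p j) v) ⟩
             x * (p i u * ∂ a (p j) v)           ≈⟨ solve 3 (λ x a b → x :* (a :* b) := (x :* b) :* a) refl x (p i u) _ ⟩
             x * ∂ a (p j) v * p i u             ≈⟨ *-congʳ (P-suc a x j f v) ⟨
             nat (suc j) * p (suc j) v * p i u   ≈⟨ solve 3 (λ m b a → (m :* b) :* a := m :* (a :* b)) refl (nat (suc j)) _ (p i u) ⟩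
             nat (suc j) * (p i u * p (suc j) v) ∎) ⟩
        conv n (λ i j → nat (suc j) * (p i u * p (suc j) v)) ∎

    -- A product of grouplike series is grouplike. All shuffles have length |u| + |v|, so one
    -- truncation serves them all; `sum≤-*` then factors the double sum, since the n-th term
    -- vanishes on words shorter than n.
    E-isCharacter : IsCharacter (E a x f)
    E-isCharacter u v = begin
      pair (E a x f) u v
        ≈⟨ sumL-congᴬ (All.map (λ {s} e → reflexive (≡.cong (λ m → sum≤ m (λ n → p n s)) e)) (shuffle-length u v)) ⟩
      pair (λ s → sum≤ (length u ℕ.+ length v) (λ n → p n s)) u v
        ≈⟨ sumL-conv (length u ℕ.+ length v) (λ n _ s → p n s) (shuffle u v) ⟩
      sum≤ (length u ℕ.+ length v) (λ n → pair (p n) u v)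
        ≈⟨ conv-cong (length u ℕ.+ length v) (λ n _ _ → pair-P n u v) ⟩
      sum≤ (length u ℕ.+ length v) (λ n → conv n (λ i j → p i u * p j v))
        ≈⟨ sum≤-* (length u) (length v) (λ i → p i u) (λ j → p j v) (long u) (long v) ⟨
      E a x f u * E a x f v ∎
      where
      long : ∀ w i → length w ℕ.< i → p i w ≈ 0#
      long w i l = trans (*-congˡ (∂^-long a i f w l)) (zeroʳ _)

-- The ordered exponential as a sum over decreasing sequences

length-toWord : ∀ as → length as ℕ.≤ length (toWord as)
length-toWord []       = ℕ.z≤n
length-toWord (a ∷ as) = ℕ.s≤s (ℕₚ.≤-trans (length-toWord as)
  (≡.subst (length (toWord as) ℕ.≤_) (≡.sym (length-++ (replicate a false))) (ℕₚ.m≤n+m _ _)))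

module OrderedExponential {c ℓ} (R : CommutativeRing c ℓ)
  (inv : ℕ → CommutativeRing.Carrier R) (inv-inverse : Convolution.InvertsNats R inv)
  (g : ℕ → CommutativeRing.Carrier R) where

  open CommutativeRing R hiding (zero)
  open Convolution R
  open DividedPowers R inv inv-inverse
  open ShuffleCharacters R inv inv-inverse
  open Relation.Binary.Reasoning.Setoid setoid
  open Solver commutativeSemiring using (solve; _:=_; _:+_; _:*_; con)

  convTail : ℕ → (ℕ → ℕ → Carrier) → Carrier
  convTail zero    F = 0#
  convTail (suc n) F = conv n (λ i j → F (suc i) j)

  conv-head : ∀ n F → conv n F ≈ F 0 n + convTail n F
  conv-head zero    F = sym (+-identityʳ _)
  conv-head (suc n) F = refl

  convTail-cong : ∀ n {F G : ℕ → ℕ → Carrier} →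
                  (∀ i j → suc i ℕ.+ j ≡ n → F (suc i) j ≈ G (suc i) j) → convTail n F ≈ convTail n G
  convTail-cong zero    h = refl
  convTail-cong (suc n) h = conv-cong n λ i j e → h i j (≡.cong suc e)

  convTail-*ˡ : ∀ n x F → convTail n (λ i j → x * F i j) ≈ x * convTail n F
  convTail-*ˡ zero    x F = sym (zeroʳ x)
  convTail-*ˡ (suc n) x F = conv-*ˡ n x _

  zeros : ℕ → Word → Word
  zeros n w = replicate n false ++ w

  ∂-toWord : ∀ i f as → ∂^ false (suc i) f (toWord as) ≈ 0#
  ∂-toWord i f []       = refl
  ∂-toWord i f (_ ∷ as) = refl

  ∂^-zeros : ∀ i j f w → ∂^ false i f (zeros (i ℕ.+ j) w) ≡ f (zeros j w)
  ∂^-zeros zero    j f w = ≡.refl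
  ∂^-zeros (suc i) j f w = ∂^-zeros i j f w

  ∂^-zeros-long : ∀ n i f as → n ℕ.< i → ∂^ false i f (zeros n (toWord as)) ≈ 0#
  ∂^-zeros-long zero    (suc i) f as l         = ∂-toWord i f as
  ∂^-zeros-long (suc n) (suc i) f as (ℕ.s≤s l) = ∂^-zeros-long n i f as l

  ∂^-ones-long : ∀ i f as → length as ℕ.< i → ∂^ true i f (toWord as) ≈ 0#
  ∂^-ones-long (suc i)       f []             l         = refl
  ∂^-ones-long (suc i)       f (zero  ∷ as)   (ℕ.s≤s l) = ∂^-ones-long i f as l
  ∂^-ones-long (suc (suc i)) f (suc a ∷ as)   l         = refl
  ∂^-ones-long (suc zero)    f (suc a ∷ as)   (ℕ.s≤s ())

  -- The leading zeros are followed by a 1 or by the end of the word, so the terms of exp(x e₀)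
  -- beyond the n-th find nothing to strip.
  E-zeros : ∀ x f n as →
            E false x f (zeros n (toWord as)) ≈ conv n (λ i j → dp x i * f (zeros j (toWord as)))
  E-zeros x f n as = begin
    sum≤ (length (zeros n (toWord as))) p
      ≈⟨ reflexive (≡.cong (λ m → sum≤ m p) len) ⟩
    sum≤ (length (toWord as) ℕ.+ n) p
      ≈⟨ sum≤-stable n (length (toWord as)) p (λ i l → trans (*-congˡ (∂^-zeros-long n i f as l)) (zeroʳ _)) ⟩
    sum≤ n p
      ≈⟨ conv-cong n (λ { i j ≡.refl → *-congˡ (reflexive (∂^-zeros i j f (toWord as))) }) ⟩
    conv n (λ i j → dp x i * f (zeros j (toWord as))) ∎
    where
    p : ℕ → Carrier
    p i = P false x i f (zeros n (toWord as))
    len : length (zeros n (toWord as)) ≡ length (toWord as) ℕ.+ n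
    len = ≡.trans (length-++ (replicate n false))
            (≡.trans (≡.cong (ℕ._+ length (toWord as)) (length-replicate n)) (ℕₚ.+-comm n _))

  -- The law exp(x e₀) exp(y e₀) = exp((x + y) e₀), obtained from `dp-+`; it lets gaps grow one unit
  -- at a time.
  E-+ : ∀ x y f n as →
        E false x (E false y f) (zeros n (toWord as)) ≈ E false (x + y) f (zeros n (toWord as))
  E-+ x y f n as = begin
    E false x (E false y f) (zeros n (toWord as))
      ≈⟨ E-zeros x _ n as ⟩
    conv n (λ i m → dp x i * E false y f (zeros m (toWord as)))
      ≈⟨ conv-cong n (λ i m _ → trans (*-congˡ (E-zeros y f m as)) (sym (conv-*ˡ m (dp x i) _))) ⟩
    conv n (λ i m → conv m (λ k l → dp x i * (dp y k * F l)))
      ≈⟨ conv-assoc n (λ i k l → dp x i * (dp y k * F l)) ⟨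
    conv n (λ m l → conv m (λ i k → dp x i * (dp y k * F l)))
      ≈⟨ conv-cong n (λ m l _ → trans (conv-cong m (λ i k _ → sym (*-assoc _ _ _))) (conv-*ʳ m (F l) _)) ⟩
    conv n (λ m l → conv m (λ i k → dp x i * dp y k) * F l)
      ≈⟨ conv-cong n (λ m l _ → *-congʳ (dp-+ x y m)) ⟨
    conv n (λ m l → dp (x + y) m * F l)
      ≈⟨ E-zeros (x + y) f n as ⟨
    E false (x + y) f (zeros n (toWord as)) ∎
    where
    F : ℕ → Carrier
    F l = f (zeros l (toWord as))

  E-toWord : ∀ x f as → E false x f (toWord as) ≈ f (toWord as)
  E-toWord x f as = trans (E-zeros x f 0 as) (*-identityˡ _)

  E-true-false : ∀ x f w → E true x f (false ∷ w) ≈ f (false ∷ w)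
  E-true-false x f w = trans (+-cong (*-identityˡ _) (conv-zero (length w) (λ i _ _ → zeroʳ (dp x (suc i))))) (+-identityʳ _)

  -- The sum is cut at the number of letters 1 rather than at the length of the word, so that it
  -- ranges over the same multiplicities as one step of `desc`.
  E-ones : ∀ x f as →
           E true x f (toWord as) ≈
           f (toWord as) + convTail (length as) (λ i _ → dp x i * ∂^ true i f (toWord as))
  E-ones x f as = begin
    sum≤ (length (toWord as)) p
      ≈⟨ reflexive (≡.cong (λ m → sum≤ m p) (≡.sym (ℕₚ.m∸n+n≡m (length-toWord as)))) ⟩
    sum≤ (length (toWord as) ℕ.∸ length as ℕ.+ length as) p
      ≈⟨ sum≤-stable (length as) (length (toWord as) ℕ.∸ length as) p (λ i l → trans (*-congˡ (∂^-ones-long i f as l)) (zeroʳ _)) ⟩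
    sum≤ (length as) p
      ≈⟨ conv-head (length as) _ ⟩
    1# * f (toWord as) + convTail (length as) (λ i _ → p i)
      ≈⟨ +-congʳ (*-identityˡ _) ⟩
    f (toWord as) + convTail (length as) (λ i _ → p i) ∎
    where
    p : ℕ → Carrier
    p i = P true x i f (toWord as)

  ε : Word → Carrier
  ε []      = 1#
  ε (_ ∷ _) = 0#

  ε-isCharacter : IsCharacter ε
  ε-isCharacter []      v       = trans (+-identityʳ _) (sym (*-identityˡ _))
  ε-isCharacter (x ∷ u) []      = trans (+-identityʳ _) (sym (*-identityʳ _))
  ε-isCharacter (x ∷ u) (y ∷ v) = begin
    pair ε (x ∷ u) (y ∷ v) ≈⟨ pair-∷∷ ε x u y v ⟩
    pair (λ _ → 0#) u (y ∷ v) + pair (λ _ → 0#) (x ∷ u) v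
      ≈⟨ +-cong (null (shuffle u (y ∷ v))) (null (shuffle (x ∷ u) v)) ⟩
    0# + 0#                ≈⟨ +-identityˡ _ ⟩
    0#                     ≈⟨ zeroˡ 0# ⟨
    0# * 0# ∎
    where
    null : (ws : List Word) → sumL (λ _ → 0#) ws ≈ 0#
    null []       = refl
    null (_ ∷ ws) = trans (+-identityˡ _) (null ws)

  -- exp(gₙ e₁) exp(e₀) ⋯ exp(g₁ e₁) exp(e₀): the letter 0 is integrated along [0,n],
  -- the letter 1 has mass gᵤ at the integer u.
  Φ : ℕ → Word → Carrier
  Φ zero    = ε
  Φ (suc n) = E true (g (suc n)) (E false (nat 1) (Φ n))

  Φ-isCharacter : ∀ n → IsCharacter (Φ n)
  Φ-isCharacter zero    = ε-isCharacter
  Φ-isCharacter (suc n) = E-isCharacter true _ _ (E-isCharacter false _ _ (Φ-isCharacter n))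

  -- the sum of ∏ᵤ gᵤ^{mᵤ}/mᵤ! · G(n^{mₙ} ⋯ 1^{m₁}) over m₁ + ⋯ + mₙ = r
  desc : ℕ → ℕ → (List ℕ → Carrier) → Carrier
  desc zero    zero    G = G []
  desc zero    (suc r) G = 0#
  desc (suc n) r       G = conv r (λ i j → dp (g (suc n)) i * desc n j (λ e → G (replicate i (suc n) ++ e)))

  desc-cong : ∀ n r {G H : List ℕ → Carrier} → (∀ e → length e ≡ r → G e ≈ H e) → desc n r G ≈ desc n r H
  desc-cong zero    zero    h = h [] ≡.refl
  desc-cong zero    (suc r) h = refl
  desc-cong (suc n) r       h = conv-cong r λ { i j ≡.refl → *-congˡ (desc-cong n j λ e le →
    h _ (≡.trans (length-++ (replicate i (suc n))) (≡.cong₂ ℕ._+_ (length-replicate i) le))) }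

  desc-*ˡ : ∀ n r x G → desc n r (λ e → x * G e) ≈ x * desc n r G
  desc-*ˡ zero    zero    x G = refl
  desc-*ˡ zero    (suc r) x G = sym (zeroʳ x)
  desc-*ˡ (suc n) r       x G = trans (conv-cong r λ i j _ → trans (*-congˡ (desc-*ˡ n j x _))
    (solve 3 (λ a b c → a :* (b :* c) := b :* (a :* c)) refl _ x _)) (conv-*ˡ r x _)

  -- Copies of one point are at distance 0, so the factor 0^a/a! vanishes unless a = 0. This matches
  -- `∂^ true`, which needs the stripped letters 1 to be adjacent. The hypothesis on `f` takes care
  -- of the gap below the last copy.
  desc-replicate : ∀ n (f : Word → Carrier) →
        (∀ a as → desc n (length as) (λ e → ex (diffs (suc n ∷ e)) (a ∷ as)) ≈ f (zeros a (toWord as))) →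
        ∀ i j as → length as ≡ suc i ℕ.+ j →
        desc n j (λ e → ex (diffs (replicate (suc i) (suc n) ++ e)) as) ≈ ∂^ true (suc i) f (toWord as)
  desc-replicate n f h zero    j (a ∷ as)     ≡.refl = h a as
  desc-replicate n f h (suc i) j (zero ∷ as)  eq = begin
    desc n j (λ e → 1# * ex (diffs (replicate (suc i) (suc n) ++ e)) as)
      ≈⟨ desc-cong n j (λ e _ → *-identityˡ _) ⟩
    desc n j (λ e → ex (diffs (replicate (suc i) (suc n) ++ e)) as)
      ≈⟨ desc-replicate n f h i j as (ℕₚ.suc-injective eq) ⟩
    ∂^ true (suc i) f (toWord as) ∎
  desc-replicate n f h (suc i) j (suc a ∷ as) eq = begin
    desc n j (λ e → dp (nat (suc n) - nat (suc n)) (suc a) * ex (diffs (replicate (suc i) (suc n) ++ e)) as)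
      ≈⟨ desc-*ˡ n j _ _ ⟩
    dp (nat (suc n) - nat (suc n)) (suc a) * desc n j (λ e → ex (diffs (replicate (suc i) (suc n) ++ e)) as)
      ≈⟨ *-congʳ (trans (dp-cong (suc a) (-‿inverseʳ _)) (dp-0 a)) ⟩
    0# * desc n j (λ e → ex (diffs (replicate (suc i) (suc n) ++ e)) as)
      ≈⟨ zeroˡ _ ⟩
    0# ∎

  -- The state just after a letter 1 at d + n: the zeros that follow still have length d to
  -- run through before the masses at u ≤ n come into play.
  desc-Φ-gap : ∀ n d a as →
               desc n (length as) (λ e → ex (diffs ((d ℕ.+ n) ∷ e)) (a ∷ as)) ≈
               E false (nat d) (Φ n) (zeros a (toWord as))
  desc-Φ-gap zero d a as = trans (lem as) (sym (E-zeros (nat d) ε a as))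
    where
    lem : ∀ as → desc zero (length as) (λ e → ex (diffs ((d ℕ.+ 0) ∷ e)) (a ∷ as)) ≈
                 conv a (λ i j → dp (nat d) i * ε (zeros j (toWord as)))
    lem (_ ∷ as) = sym (conv-zero a (λ { i zero _ → zeroʳ _ ; i (suc j) _ → zeroʳ _ }))
    lem [] = begin
      dp (nat (d ℕ.+ 0) - 0#) a * 1#
        -- No point is left, so the gap ends at u₀ = 0 and has length d.
        ≈⟨ *-congʳ (dp-cong a (trans (+-cong (reflexive (≡.cong nat (ℕₚ.+-identityʳ d))) -0≈0) (+-identityʳ _))) ⟩
      dp (nat d) a * 1#
        ≈⟨ last a ⟨
      conv a (λ i j → dp (nat d) i * ε (zeros j [])) ∎
      where
      -0≈0 : - 0# ≈ 0#
      -0≈0 = trans (sym (+-identityˡ _)) (-‿inverseʳ 0#)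
      last : ∀ a → conv a (λ i j → dp (nat d) i * ε (zeros j [])) ≈ dp (nat d) a * 1#
      last zero    = refl
      last (suc a) = trans (conv-last a (λ i j → dp (nat d) i * ε (zeros j [])))
                       (trans (+-congʳ (conv-zero a (λ i j _ → zeroʳ _))) (+-identityˡ _))
  desc-Φ-gap (suc n) d a as = begin
    conv r (λ i j → dp γ i * desc n j (λ e → ex (diffs ((d ℕ.+ suc n) ∷ replicate i (suc n) ++ e)) (a ∷ as)))
      ≈⟨ conv-head r _ ⟩
    1# * desc n r (λ e → ex (diffs ((d ℕ.+ suc n) ∷ e)) (a ∷ as)) + convTail r (λ i j → dp γ i * desc n j (λ e → ex (diffs ((d ℕ.+ suc n) ∷ replicate i (suc n) ++ e)) (a ∷ as)))
      ≈⟨ +-cong (trans (*-identityˡ _) first) rest ⟩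
    conv a (λ i j → dp (nat d) i * ψ (zeros j (toWord as))) + dp (nat d) a * X
      ≈⟨ +-congˡ (pick a) ⟨
    conv a (λ i j → dp (nat d) i * ψ (zeros j (toWord as))) + conv a (λ i j → dp (nat d) i * atZero j)
      ≈⟨ conv-+ a _ _ ⟨
    conv a (λ i j → dp (nat d) i * ψ (zeros j (toWord as)) + dp (nat d) i * atZero j)
      ≈⟨ conv-cong a (λ i j _ → trans (sym (distribˡ _ _ _)) (*-congˡ (split j))) ⟩
    conv a (λ i j → dp (nat d) i * Φ (suc n) (zeros j (toWord as)))
      ≈⟨ E-zeros (nat d) (Φ (suc n)) a as ⟨
    E false (nat d) (Φ (suc n)) (zeros a (toWord as)) ∎
    where
    r = length as
    γ = g (suc n)
    ψ : Word → Carrier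
    ψ = E false (nat 1) (Φ n)
    X : Carrier
    X = convTail r (λ i _ → dp γ i * ∂^ true i ψ (toWord as))
    -- The correction from `ψ` to `Φ (suc n)` on j zeros followed by `toWord as`: exp(γ e₁) acts
    -- trivially unless the leading letter is 1, hence only j = 0 contributes.
    atZero : ℕ → Carrier
    atZero zero    = X
    atZero (suc _) = 0#
    split : ∀ j → ψ (zeros j (toWord as)) + atZero j ≈ Φ (suc n) (zeros j (toWord as))
    split zero    = sym (E-ones γ ψ as)
    split (suc j) = trans (+-identityʳ _) (sym (E-true-false γ ψ _))
    pick : ∀ a → conv a (λ i j → dp (nat d) i * atZero j) ≈ dp (nat d) a * X
    pick zero    = refl
    pick (suc a) = trans (conv-last a (λ i j → dp (nat d) i * atZero j))
                     (trans (+-congʳ (conv-zero a (λ i j _ → zeroʳ _))) (+-identityˡ _))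
    first : desc n r (λ e → ex (diffs ((d ℕ.+ suc n) ∷ e)) (a ∷ as)) ≈
            conv a (λ i j → dp (nat d) i * ψ (zeros j (toWord as)))
    first = begin
      desc n r (λ e → ex (diffs ((d ℕ.+ suc n) ∷ e)) (a ∷ as))
        ≈⟨ reflexive (≡.cong (λ m → desc n r (λ e → ex (diffs (m ∷ e)) (a ∷ as))) (ℕₚ.+-suc d n)) ⟩
      desc n r (λ e → ex (diffs ((suc d ℕ.+ n) ∷ e)) (a ∷ as))
        ≈⟨ desc-Φ-gap n (suc d) a as ⟩
      E false (nat (suc d)) (Φ n) (zeros a (toWord as))
        ≈⟨ E-cong false (solve 2 (λ o d → o :+ d := d :+ (o :+ con 0)) refl 1# (nat d)) (λ _ → refl) (zeros a (toWord as)) ⟩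
      E false (nat d + nat 1) (Φ n) (zeros a (toWord as))
        -- The last unit of the gap is the factor exp(e₀) contained in `ψ`.
        ≈⟨ E-+ (nat d) (nat 1) (Φ n) a as ⟨
      E false (nat d) ψ (zeros a (toWord as))
        ≈⟨ E-zeros (nat d) ψ a as ⟩
      conv a (λ i j → dp (nat d) i * ψ (zeros j (toWord as))) ∎
    gap : nat (d ℕ.+ suc n) - nat (suc n) ≈ nat d
    gap = trans (+-congʳ (nat-+ d (suc n))) (trans (+-assoc _ _ _) (trans (+-congˡ (-‿inverseʳ _)) (+-identityʳ _)))
    rest : convTail r (λ i j → dp γ i * desc n j (λ e → ex (diffs ((d ℕ.+ suc n) ∷ replicate i (suc n) ++ e)) (a ∷ as))) ≈
           dp (nat d) a * X
    rest = begin
      convTail r (λ i j → dp γ i * desc n j (λ e → ex (diffs ((d ℕ.+ suc n) ∷ replicate i (suc n) ++ e)) (a ∷ as)))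
        ≈⟨ convTail-cong r (λ i j e → begin
           dp γ (suc i) * desc n j (λ e → dp (nat (d ℕ.+ suc n) - nat (suc n)) a * ex (diffs (replicate (suc i) (suc n) ++ e)) as)
             ≈⟨ *-congˡ (desc-*ˡ n j _ _) ⟩
           dp γ (suc i) * (dp (nat (d ℕ.+ suc n) - nat (suc n)) a * desc n j (λ e → ex (diffs (replicate (suc i) (suc n) ++ e)) as))
             ≈⟨ *-congˡ (*-cong (dp-cong a gap) (desc-replicate n ψ (desc-Φ-gap n 1) i j as (≡.sym e))) ⟩
           dp γ (suc i) * (dp (nat d) a * ∂^ true (suc i) ψ (toWord as))
             ≈⟨ solve 3 (λ a b c → a :* (b :* c) := b :* (a :* c)) refl (dp γ (suc i)) (dp (nat d) a) _ ⟩
           dp (nat d) a * (dp γ (suc i) * ∂^ true (suc i) ψ (toWord as)) ∎) ⟩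
      convTail r (λ i j → dp (nat d) a * (dp γ i * ∂^ true i ψ (toWord as)))
        ≈⟨ convTail-*ˡ r (dp (nat d) a) _ ⟩
      dp (nat d) a * X ∎

  -- A fictitious letter 1 at the point n, followed by no zeros, contributes the factor x⁰/0! = 1
  -- and puts the sum into the form of `desc-Φ-gap` with d = 0.
  desc-Φ : ∀ n as → desc n (length as) (λ e → ex (diffs e) as) ≈ Φ n (toWord as)
  desc-Φ n as = begin
    desc n (length as) (λ e → ex (diffs e) as)
      ≈⟨ desc-cong n (length as) (λ e _ → *-identityˡ _) ⟨
    desc n (length as) (λ e → ex (diffs (n ∷ e)) (0 ∷ as))
      ≈⟨ desc-Φ-gap n 0 0 as ⟩
    E false (nat 0) (Φ n) (toWord as)
      ≈⟨ E-toWord (nat 0) (Φ n) as ⟩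
    Φ n (toWord as) ∎

-- Substitution of linear forms into exponentials

module LinearSubstitution {ℓ} (R : CommutativeRing 0ℓ ℓ)
  (inv : ℕ → CommutativeRing.Carrier R) (inv-inverse : Convolution.InvertsNats R inv) where

  open CommutativeRing R hiding (zero)
  open Convolution R
  open DividedPowers R inv inv-inverse
  open Relation.Binary.Reasoning.Setoid setoid
  open Solver commutativeSemiring using (solve; _:=_; _:+_; _:*_)

  Form : Set
  Form = List Carrier

  Coeff : Set
  Coeff = List ℕ → Carrier

  -- F is the family of coefficients of a series, which gets multiplied by the linear form
  mulBy : Form → Coeff → Coeff
  mulBy []      F a           = 0#
  mulBy (l ∷ L) F []          = 0#
  mulBy (l ∷ L) F (zero  ∷ a) = mulBy L (λ a′ → F (zero ∷ a′)) a
  mulBy (l ∷ L) F (suc x ∷ a) = l * F (x ∷ a) + mulBy L (λ a′ → F (suc x ∷ a′)) a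

  -- Agreement is required only in total degree one lower and in the same number of variables, which
  -- is exactly what an induction on the degree supplies.
  mulBy-cong : ∀ L {F G : Coeff} a →
           (∀ a′ → length a′ ≡ length a → suc (sumN a′) ≡ sumN a → F a′ ≈ G a′) → mulBy L F a ≈ mulBy L G a
  mulBy-cong []      a           h = refl
  mulBy-cong (l ∷ L) []          h = refl
  mulBy-cong (l ∷ L) (zero  ∷ a) h = mulBy-cong L a λ a′ e s → h (zero ∷ a′) (≡.cong suc e) s
  mulBy-cong (l ∷ L) (suc x ∷ a) h =
    +-cong (*-congˡ (h (x ∷ a) ≡.refl ≡.refl))
           (mulBy-cong L a λ a′ e s → h (suc x ∷ a′) (≡.cong suc e)
             (≡.trans (≡.cong suc (≡.sym (ℕₚ.+-suc x (sumN a′)))) (≡.cong (suc x ℕ.+_) s)))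

  mulBy-+ : ∀ L (F G : Coeff) a → mulBy L (λ a′ → F a′ + G a′) a ≈ mulBy L F a + mulBy L G a
  mulBy-+ []      F G a           = sym (+-identityˡ _)
  mulBy-+ (l ∷ L) F G []          = sym (+-identityˡ _)
  mulBy-+ (l ∷ L) F G (zero  ∷ a) = mulBy-+ L _ _ a
  mulBy-+ (l ∷ L) F G (suc x ∷ a) = trans (+-congˡ (mulBy-+ L _ _ a))
    (solve 5 (λ l a b x y → l :* (a :+ b) :+ (x :+ y) := (l :* a :+ x) :+ (l :* b :+ y)) refl l _ _ _ _)

  mulBy-*ˡ : ∀ L x (F : Coeff) a → mulBy L (λ a′ → x * F a′) a ≈ x * mulBy L F a
  mulBy-*ˡ []      x F a           = sym (zeroʳ x)
  mulBy-*ˡ (l ∷ L) x F []          = sym (zeroʳ x)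
  mulBy-*ˡ (l ∷ L) x F (zero  ∷ a) = mulBy-*ˡ L x _ a
  mulBy-*ˡ (l ∷ L) x F (suc n ∷ a) = trans (+-congˡ (mulBy-*ˡ L x _ a))
    (solve 4 (λ l x f t → l :* (x :* f) :+ x :* t := x :* (l :* f :+ t)) refl l x _ _)

  mulBy-0 : ∀ L a → mulBy L (λ _ → 0#) a ≈ 0#
  mulBy-0 []      a           = refl
  mulBy-0 (l ∷ L) []          = refl
  mulBy-0 (l ∷ L) (zero  ∷ a) = mulBy-0 L a
  mulBy-0 (l ∷ L) (suc x ∷ a) = trans (+-cong (zeroʳ l) (mulBy-0 L a)) (+-identityˡ _)

  mulBy-conv : ∀ L n (F : ℕ → ℕ → Coeff) a →
           mulBy L (λ a′ → conv n (λ i j → F i j a′)) a ≈ conv n (λ i j → mulBy L (F i j) a)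
  mulBy-conv L zero    F a = refl
  mulBy-conv L (suc n) F a = trans (mulBy-+ L _ _ a) (+-congˡ (mulBy-conv L n _ a))

  -- The exponents 0, 1 and at least 2 are separated because the two forms can both lower the first
  -- exponent only in the last case.
  mulBy-comm : ∀ L M (F : Coeff) a → mulBy L (mulBy M F) a ≈ mulBy M (mulBy L F) a
  mulBy-comm []      M       F a                 = sym (mulBy-0 M a)
  mulBy-comm (l ∷ L) []      F a                 = mulBy-0 (l ∷ L) a
  mulBy-comm (l ∷ L) (m ∷ M) F []                = refl
  mulBy-comm (l ∷ L) (m ∷ M) F (zero ∷ a)        = mulBy-comm L M _ a
  mulBy-comm (l ∷ L) (m ∷ M) F (suc zero ∷ a)    = begin
    l * mulBy M F₀ a + mulBy L (λ a′ → m * F₀ a′ + mulBy M F₁ a′) a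
      ≈⟨ +-congˡ (trans (mulBy-+ L _ _ a) (+-cong (mulBy-*ˡ L m F₀ a) (mulBy-comm L M F₁ a))) ⟩
    l * mulBy M F₀ a + (m * mulBy L F₀ a + mulBy M (mulBy L F₁) a)
      ≈⟨ solve 3 (λ x y z → x :+ (y :+ z) := y :+ (x :+ z)) refl _ _ _ ⟩
    m * mulBy L F₀ a + (l * mulBy M F₀ a + mulBy M (mulBy L F₁) a)
      ≈⟨ +-congˡ (trans (mulBy-+ M _ _ a) (+-congʳ (mulBy-*ˡ M l F₀ a))) ⟨
    m * mulBy L F₀ a + mulBy M (λ a′ → l * F₀ a′ + mulBy L F₁ a′) a ∎
    where
    F₀ F₁ : Coeff
    F₀ a′ = F (0 ∷ a′)
    F₁ a′ = F (1 ∷ a′)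
  mulBy-comm (l ∷ L) (m ∷ M) F (suc (suc x) ∷ a) = begin
    l * (m * F (x ∷ a) + mulBy M F₀ a) + mulBy L (λ a′ → m * F₀ a′ + mulBy M F₁ a′) a
      ≈⟨ +-congˡ (trans (mulBy-+ L _ _ a) (+-cong (mulBy-*ˡ L m F₀ a) (mulBy-comm L M F₁ a))) ⟩
    l * (m * F (x ∷ a) + mulBy M F₀ a) + (m * mulBy L F₀ a + mulBy M (mulBy L F₁) a)
      ≈⟨ solve 6 (λ l m f x y z → l :* (m :* f :+ x) :+ (m :* y :+ z) := m :* (l :* f :+ y) :+ (l :* x :+ z)) refl l m _ _ _ _ ⟩
    m * (l * F (x ∷ a) + mulBy L F₀ a) + (l * mulBy M F₀ a + mulBy M (mulBy L F₁) a)
      ≈⟨ +-congˡ (trans (mulBy-+ M _ _ a) (+-congʳ (mulBy-*ˡ M l F₀ a))) ⟨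
    m * (l * F (x ∷ a) + mulBy L F₀ a) + mulBy M (λ a′ → l * F₀ a′ + mulBy L F₁ a′) a ∎
    where
    F₀ F₁ : Coeff
    F₀ a′ = F (suc x ∷ a′)
    F₁ a′ = F (suc (suc x) ∷ a′)

  -- The Euler operator Σ xᵢ ∂ᵢ multiplies e^{v·x} by v·x, and multiplies the coefficient of x^a by
  -- |a|.
  mulBy-euler : ∀ v a → length v ≡ length a → mulBy v (ex v) a ≈ nat (sumN a) * ex v a
  mulBy-euler []      []          e = sym (zeroˡ _)
  mulBy-euler (x ∷ v) (zero  ∷ a) e = begin
    mulBy v (λ a′ → 1# * ex v a′) a  ≈⟨ mulBy-*ˡ v 1# (ex v) a ⟩
    1# * mulBy v (ex v) a            ≈⟨ *-congˡ (mulBy-euler v a (ℕₚ.suc-injective e)) ⟩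
    1# * (nat (sumN a) * ex v a) ≈⟨ solve 3 (λ o n e → o :* (n :* e) := n :* (o :* e)) refl 1# _ _ ⟩
    nat (sumN a) * (1# * ex v a) ∎
  mulBy-euler (x ∷ v) (suc n ∷ a) e = begin
    x * (dp x n * ex v a) + mulBy v (λ a′ → dp x (suc n) * ex v a′) a
      ≈⟨ +-cong (trans (sym (*-assoc _ _ _)) (*-congʳ (sym (dp-suc x n)))) (mulBy-*ˡ v _ (ex v) a) ⟩
    nat (suc n) * dp x (suc n) * ex v a + dp x (suc n) * mulBy v (ex v) a
      ≈⟨ +-congˡ (*-congˡ (mulBy-euler v a (ℕₚ.suc-injective e))) ⟩
    nat (suc n) * dp x (suc n) * ex v a + dp x (suc n) * (nat (sumN a) * ex v a)
      ≈⟨ solve 4 (λ n d e s → n :* d :* e :+ d :* (s :* e) := (n :+ s) :* (d :* e)) refl (nat (suc n)) (dp x (suc n)) (ex v a) (nat (sumN a)) ⟩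
    (nat (suc n) + nat (sumN a)) * (dp x (suc n) * ex v a)
      ≈⟨ *-congʳ (nat-+ (suc n) (sumN a)) ⟨
    nat (suc n ℕ.+ sumN a) * (dp x (suc n) * ex v a) ∎

  addMul : Form → Carrier → Form → Form
  addMul []      w L       = map (w *_) L
  addMul (x ∷ v) w []      = x ∷ v
  addMul (x ∷ v) w (l ∷ L) = (x + w * l) ∷ addMul v w L

  length-addMul : ∀ v w L → length v ≡ length L → length (addMul v w L) ≡ length L
  length-addMul []      w []      e = ≡.refl
  length-addMul (x ∷ v) w (l ∷ L) e = ≡.cong suc (length-addMul v w L (ℕₚ.suc-injective e))

  mulBy-addMul : ∀ v w L → length v ≡ length L → ∀ (F : Coeff) a → mulBy (addMul v w L) F a ≈ mulBy v F a + w * mulBy L F a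
  mulBy-addMul []      w []      e F a           = sym (trans (+-congˡ (zeroʳ w)) (+-identityˡ _))
  mulBy-addMul (x ∷ v) w (l ∷ L) e F []          = sym (trans (+-congˡ (zeroʳ w)) (+-identityˡ _))
  mulBy-addMul (x ∷ v) w (l ∷ L) e F (zero  ∷ a) = mulBy-addMul v w L (ℕₚ.suc-injective e) _ a
  mulBy-addMul (x ∷ v) w (l ∷ L) e F (suc n ∷ a) = trans (+-congˡ (mulBy-addMul v w L (ℕₚ.suc-injective e) _ a))
    (solve 6 (λ x w l f s t → (x :+ w :* l) :* f :+ (s :+ w :* t) := (x :* f :+ s) :+ w :* (l :* f :+ t)) refl x w l _ _ _)

  mulBy^ : Form → ℕ → Coeff → Coeff
  mulBy^ L zero    F = F
  mulBy^ L (suc n) F = mulBy L (mulBy^ L n F)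

  mulBy^-cong : ∀ L i {F G : Coeff} a →
            (∀ a′ → length a′ ≡ length a → i ℕ.+ sumN a′ ≡ sumN a → F a′ ≈ G a′) → mulBy^ L i F a ≈ mulBy^ L i G a
  mulBy^-cong L zero    a h = h a ≡.refl ≡.refl
  mulBy^-cong L (suc i) a h = mulBy-cong L a λ a′ e s → mulBy^-cong L i a′ λ a″ e′ s′ →
    h a″ (≡.trans e′ e) (≡.trans (≡.cong suc s′) s)

  -- The form `v` commutes past the i factors `L` and meets the degree j part of e^{v·x}, where
  -- `mulBy-euler` yields the factor j.
  mulBy^-ex : ∀ L v i j a → length v ≡ length a → sumN a ≡ i ℕ.+ j →
          nat j * mulBy^ L i (ex v) a ≈ mulBy v (mulBy^ L i (ex v)) a
  mulBy^-ex L v zero    j a e s = trans (*-congʳ (reflexive (≡.cong nat (≡.sym s)))) (sym (mulBy-euler v a e))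
  mulBy^-ex L v (suc i) j a e s = begin
    nat j * mulBy L (mulBy^ L i (ex v)) a          ≈⟨ mulBy-*ˡ L (nat j) _ a ⟨
    mulBy L (λ a′ → nat j * mulBy^ L i (ex v) a′) a ≈⟨ mulBy-cong L a (λ a′ e′ s′ → mulBy^-ex L v i j a′ (≡.trans e (≡.sym e′)) (ℕₚ.suc-injective (≡.trans s′ s))) ⟩
    mulBy L (mulBy v (mulBy^ L i (ex v))) a            ≈⟨ mulBy-comm L v _ a ⟩
    mulBy v (mulBy L (mulBy^ L i (ex v))) a ∎

  ex-sum0 : ∀ v a → sumN a ≡ 0 → ex v a ≈ 1#
  ex-sum0 []      a          s = refl
  ex-sum0 (x ∷ v) []         s = refl
  ex-sum0 (x ∷ v) (zero ∷ a) s = trans (*-identityˡ _) (ex-sum0 v a s)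

  -- The law e^{w L(x)} e^{v·x} = e^{(v + w L)·x} in degree d. After multiplication by the degree,
  -- `conv-euler` splits the left side: one half peels off w L, the other peels off v by
  -- `mulBy^-ex`. Together they multiply by v + w L, and `mulBy-euler` evaluates this on the
  -- exponential of v + w L.
  ex-addMul : ∀ v w L d a → length v ≡ length a → length L ≡ length a → sumN a ≡ d →
              conv d (λ i _ → dp w i * mulBy^ L i (ex v) a) ≈ ex (addMul v w L) a
  ex-addMul v w L zero    a e e′ s = trans (*-identityˡ _) (trans (ex-sum0 v a s) (sym (ex-sum0 (addMul v w L) a s)))
  ex-addMul v w L (suc d) a e e′ s = nat-cancel d (begin
    nat (suc d) * conv (suc d) (λ i _ → dp w i * mulBy^ L i (ex v) a)
      ≈⟨ conv-euler d (λ i _ → dp w i * mulBy^ L i (ex v) a) ⟨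
    conv d (λ i _ → nat (suc i) * (dp w (suc i) * mulBy^ L (suc i) (ex v) a)) +
    conv d (λ i j → nat (suc j) * (dp w i * mulBy^ L i (ex v) a))
      ≈⟨ +-cong left right ⟩
    w * mulBy L (ex v′) a + mulBy v (ex v′) a
      ≈⟨ +-comm _ _ ⟩
    mulBy v (ex v′) a + w * mulBy L (ex v′) a
      ≈⟨ mulBy-addMul v w L (≡.trans e (≡.sym e′)) (ex v′) a ⟨
    mulBy v′ (ex v′) a
      ≈⟨ mulBy-euler v′ a (≡.trans (length-addMul v w L (≡.trans e (≡.sym e′))) e′) ⟩
    nat (sumN a) * ex v′ a
      ≈⟨ *-congʳ (reflexive (≡.cong nat s)) ⟩
    nat (suc d) * ex v′ a ∎)
    where
    v′ = addMul v w L
    IH : ∀ M → mulBy M (λ a′ → conv d (λ i _ → dp w i * mulBy^ L i (ex v) a′)) a ≈ mulBy M (ex v′) a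
    IH M = mulBy-cong M a λ a′ l s′ → ex-addMul v w L d a′ (≡.trans e (≡.sym l)) (≡.trans e′ (≡.sym l))
      (ℕₚ.suc-injective (≡.trans s′ s))
    left : conv d (λ i _ → nat (suc i) * (dp w (suc i) * mulBy^ L (suc i) (ex v) a)) ≈ w * mulBy L (ex v′) a
    left = begin
      conv d (λ i _ → nat (suc i) * (dp w (suc i) * mulBy^ L (suc i) (ex v) a))
        ≈⟨ conv-cong d (λ i _ _ → begin
           nat (suc i) * (dp w (suc i) * mulBy^ L (suc i) (ex v) a) ≈⟨ *-assoc _ _ _ ⟨
           nat (suc i) * dp w (suc i) * mulBy^ L (suc i) (ex v) a   ≈⟨ *-congʳ (dp-suc w i) ⟩
           w * dp w i * mulBy^ L (suc i) (ex v) a                   ≈⟨ *-assoc _ _ _ ⟩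
           w * (dp w i * mulBy L (mulBy^ L i (ex v)) a)                 ≈⟨ *-congˡ (mulBy-*ˡ L (dp w i) _ a) ⟨
           w * mulBy L (λ a′ → dp w i * mulBy^ L i (ex v) a′) a ∎) ⟩
      conv d (λ i _ → w * mulBy L (λ a′ → dp w i * mulBy^ L i (ex v) a′) a)
        ≈⟨ conv-*ˡ d w _ ⟩
      w * conv d (λ i _ → mulBy L (λ a′ → dp w i * mulBy^ L i (ex v) a′) a)
        ≈⟨ *-congˡ (mulBy-conv L d (λ i _ a′ → dp w i * mulBy^ L i (ex v) a′) a) ⟨
      w * mulBy L (λ a′ → conv d (λ i _ → dp w i * mulBy^ L i (ex v) a′)) a
        ≈⟨ *-congˡ (IH L) ⟩
      w * mulBy L (ex v′) a ∎
    right : conv d (λ i j → nat (suc j) * (dp w i * mulBy^ L i (ex v) a)) ≈ mulBy v (ex v′) a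
    right = begin
      conv d (λ i j → nat (suc j) * (dp w i * mulBy^ L i (ex v) a))
        ≈⟨ conv-cong d (λ i j ij → begin
           nat (suc j) * (dp w i * mulBy^ L i (ex v) a) ≈⟨ solve 3 (λ a b c → a :* (b :* c) := b :* (a :* c)) refl (nat (suc j)) (dp w i) _ ⟩
           dp w i * (nat (suc j) * mulBy^ L i (ex v) a) ≈⟨ *-congˡ (mulBy^-ex L v i (suc j) a e (≡.trans s (≡.trans (≡.cong suc (≡.sym ij)) (≡.sym (ℕₚ.+-suc i j))))) ⟩
           dp w i * mulBy v (mulBy^ L i (ex v)) a           ≈⟨ mulBy-*ˡ v (dp w i) _ a ⟨
           mulBy v (λ a′ → dp w i * mulBy^ L i (ex v) a′) a ∎) ⟩
      conv d (λ i _ → mulBy v (λ a′ → dp w i * mulBy^ L i (ex v) a′) a)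
        ≈⟨ mulBy-conv v d (λ i _ a′ → dp w i * mulBy^ L i (ex v) a′) a ⟨
      mulBy v (λ a′ → conv d (λ i _ → dp w i * mulBy^ L i (ex v) a′)) a
        ≈⟨ IH v ⟩
      mulBy v (ex v′) a ∎

  sumMonos : ℕ → ℕ → (List ℕ → Carrier) → Carrier
  sumMonos zero    zero    F = F []
  sumMonos zero    (suc d) F = 0#
  sumMonos (suc m) d       F = conv d (λ i j → sumMonos m j (λ b → F (i ∷ b)))

  sumMonos-cong : ∀ m d {F G : List ℕ → Carrier} → (∀ b → length b ≡ m → F b ≈ G b) → sumMonos m d F ≈ sumMonos m d G
  sumMonos-cong zero    zero    h = h [] ≡.refl
  sumMonos-cong zero    (suc d) h = refl
  sumMonos-cong (suc m) d       h = conv-cong d λ i j _ → sumMonos-cong m j λ b e → h (i ∷ b) (≡.cong suc e)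

  sumMonos-*ˡ : ∀ m d x (F : List ℕ → Carrier) → sumMonos m d (λ b → x * F b) ≈ x * sumMonos m d F
  sumMonos-*ˡ zero    zero    x F = refl
  sumMonos-*ˡ zero    (suc d) x F = sym (zeroʳ x)
  sumMonos-*ˡ (suc m) d       x F = trans (conv-cong d λ i j _ → sumMonos-*ˡ m j x _) (conv-*ˡ d x _)

  mulBy-sumMonos : ∀ L m d (F : List ℕ → Coeff) a →
               mulBy L (λ a′ → sumMonos m d (λ b → F b a′)) a ≈ sumMonos m d (λ b → mulBy L (F b) a)
  mulBy-sumMonos L zero    zero    F a = refl
  mulBy-sumMonos L zero    (suc d) F a = mulBy-0 L a
  mulBy-sumMonos L (suc m) d       F a = trans (mulBy-conv L d _ a) (conv-cong d λ i j _ → mulBy-sumMonos L m j _ a)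

  mulBy^-sumMonos : ∀ L n m d (x : List ℕ → Carrier) (F : List ℕ → Coeff) a →
                mulBy^ L n (λ a′ → sumMonos m d (λ b → x b * F b a′)) a ≈ sumMonos m d (λ b → x b * mulBy^ L n (F b) a)
  mulBy^-sumMonos L zero    m d x F a = refl
  mulBy^-sumMonos L (suc n) m d x F a = begin
    mulBy L (mulBy^ L n (λ a′ → sumMonos m d (λ b → x b * F b a′))) a
      ≈⟨ mulBy-cong L a (λ a′ _ _ → mulBy^-sumMonos L n m d x F a′) ⟩
    mulBy L (λ a′ → sumMonos m d (λ b → x b * mulBy^ L n (F b) a′)) a
      ≈⟨ mulBy-sumMonos L m d _ a ⟩
    sumMonos m d (λ b → mulBy L (λ a′ → x b * mulBy^ L n (F b) a′) a)
      ≈⟨ sumMonos-cong m d (λ b _ → mulBy-*ˡ L (x b) _ a) ⟩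
    sumMonos m d (λ b → x b * mulBy^ L (suc n) (F b) a) ∎

  linProd : List Form → Coeff
  linProd []       a = if allZero a then 1# else 0#
  linProd (L ∷ Ls) a = mulBy L (linProd Ls) a

  linProd-replicate : ∀ i L Ls a → linProd (replicate i L ++ Ls) a ≈ mulBy^ L i (linProd Ls) a
  linProd-replicate zero    L Ls a = refl
  linProd-replicate (suc i) L Ls a = mulBy-cong L a λ a′ _ _ → linProd-replicate i L Ls a′

  powers : List ℕ → List Form → List Form
  powers b Ls = foldr _++_ [] (zipWithL replicate b Ls)

  lin : ℕ → List Carrier → List Form → Form
  lin r []       Ls       = replicate r 0#
  lin r (w ∷ ws) []       = replicate r 0#
  lin r (w ∷ ws) (L ∷ Ls) = addMul (lin r ws Ls) w L

  length-lin : ∀ r ws Ls → All (λ L → length L ≡ r) Ls → length (lin r ws Ls) ≡ r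
  length-lin r []       Ls       hs       = length-replicate r
  length-lin r (w ∷ ws) []       hs       = length-replicate r
  length-lin r (w ∷ ws) (L ∷ Ls) (h ∷ hs) =
    ≡.trans (length-addMul (lin r ws Ls) w L (≡.trans (length-lin r ws Ls hs) (≡.sym h))) h

  ex-zeros : ∀ a → ex (replicate (length a) 0#) a ≈ (if allZero a then 1# else 0#)
  ex-zeros []          = refl
  ex-zeros (zero  ∷ a) = trans (*-identityˡ _) (ex-zeros a)
  ex-zeros (suc x ∷ a) = trans (*-congʳ (dp-0 x)) (zeroˡ _)

  allZero-suc : ∀ a {d} → sumN a ≡ suc d → allZero a ≡ false
  allZero-suc (zero  ∷ a) s = allZero-suc a s
  allZero-suc (suc x ∷ a) s = ≡.refl

  -- e^{w·y} at y = (L₁(x),…,L_m(x)) is e^{(Σ wₗ Lₗ)·x}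
  ex-lin : ∀ ws Ls d a → length ws ≡ length Ls → All (λ L → length L ≡ length a) Ls → sumN a ≡ d →
           sumMonos (length ws) d (λ b → ex ws b * linProd (powers b Ls) a) ≈
           ex (lin (length a) ws Ls) a
  ex-lin [] [] zero a e hs s = begin
    1# * (if allZero a then 1# else 0#)   ≈⟨ *-identityˡ _ ⟩
    (if allZero a then 1# else 0#)        ≈⟨ ex-zeros a ⟨
    ex (replicate (length a) 0#) a ∎
  ex-lin [] [] (suc d) a e hs s = sym (trans (ex-zeros a) (reflexive (≡.cong (if_then 1# else 0#) (allZero-suc a s))))
  ex-lin (w ∷ ws) (L ∷ Ls) d a e (h ∷ hs) s = begin
    conv d (λ i j → sumMonos m j (λ b → dp w i * ex ws b * linProd (replicate i L ++ powers b Ls) a))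
      ≈⟨ conv-cong d (λ i j ij → begin
         sumMonos m j (λ b → dp w i * ex ws b * linProd (replicate i L ++ powers b Ls) a)
           ≈⟨ sumMonos-cong m j (λ b _ → trans (*-assoc _ _ _) (*-congˡ (*-congˡ (linProd-replicate i L (powers b Ls) a)))) ⟩
         sumMonos m j (λ b → dp w i * (ex ws b * mulBy^ L i (linProd (powers b Ls)) a))
           ≈⟨ sumMonos-*ˡ m j (dp w i) _ ⟩
         dp w i * sumMonos m j (λ b → ex ws b * mulBy^ L i (linProd (powers b Ls)) a)
           ≈⟨ *-congˡ (mulBy^-sumMonos L i m j (ex ws) _ a) ⟨
         dp w i * mulBy^ L i (λ a′ → sumMonos m j (λ b → ex ws b * linProd (powers b Ls) a′)) a
           ≈⟨ *-congˡ (mulBy^-cong L i a (λ a′ l s′ → IH i j ij a′ l s′)) ⟩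
         dp w i * mulBy^ L i (ex (lin (length a) ws Ls)) a ∎) ⟩
    conv d (λ i _ → dp w i * mulBy^ L i (ex (lin (length a) ws Ls)) a)
      ≈⟨ ex-addMul (lin (length a) ws Ls) w L d a (length-lin (length a) ws Ls hs) h s ⟩
    ex (addMul (lin (length a) ws Ls) w L) a ∎
    where
    m = length ws
    IH : ∀ i j → i ℕ.+ j ≡ d → ∀ a′ → length a′ ≡ length a → i ℕ.+ sumN a′ ≡ sumN a →
         sumMonos m j (λ b → ex ws b * linProd (powers b Ls) a′) ≈ ex (lin (length a) ws Ls) a′
    IH i j ij a′ l s′ = trans
      (ex-lin ws Ls j a′ (ℕₚ.suc-injective e) (All.map (λ q → ≡.trans q (≡.sym l)) hs)
        (ℕₚ.+-cancelˡ-≡ i _ _ (≡.trans s′ (≡.trans s (≡.sym ij)))))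
      (reflexive (≡.cong (λ r → ex (lin r ws Ls) a′) l))

-- From compositions to weakly increasing sequences

replicate-∷ʳ : ∀ {a} {A : Set a} n (x : A) → replicate n x ++ [ x ] ≡ x ∷ replicate n x
replicate-∷ʳ zero    x = ≡.refl
replicate-∷ʳ (suc n) x = ≡.cong (x ∷_) (replicate-∷ʳ n x)

reverse-replicate : ∀ {a} {A : Set a} n (x : A) → reverse (replicate n x) ≡ replicate n x
reverse-replicate zero    x = ≡.refl
reverse-replicate (suc n) x = ≡.trans (unfold-reverse x (replicate n x))
  (≡.trans (≡.cong (_++ [ x ]) (reverse-replicate n x)) (replicate-∷ʳ n x))

-- As y_j is the sum of the i_j variables in its block, Σ u_j y_j equals Σ e_p z_p with e this list.
expand : List ℕ → List ℕ → List ℕ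
expand []       us       = []
expand (i ∷ is) []       = []
expand (i ∷ is) (u ∷ us) = replicate i u ++ expand is us

module CompositionSums {c ℓ} (R : CommutativeRing c ℓ) where
  open CommutativeRing R hiding (zero)
  open Convolution R

  -- Sum over lo < u₁ < ⋯ < u_m ≤ lo + n. The recursion asks whether lo + 1 occurs, so that it runs
  -- in step with `asc`.
  sumIncs : ℕ → ℕ → ℕ → (List ℕ → Carrier) → Carrier
  sumIncs zero    lo n       F = F []
  sumIncs (suc m) lo zero    F = 0#
  sumIncs (suc m) lo (suc n) F = sumIncs m (suc lo) n (λ us → F (suc lo ∷ us)) + sumIncs (suc m) (suc lo) n F

  sumIncs-cong : ∀ m lo n {F G : List ℕ → Carrier} → (∀ us → length us ≡ m → F us ≈ G us) → sumIncs m lo n F ≈ sumIncs m lo n G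
  sumIncs-cong zero    lo n       h = h [] ≡.refl
  sumIncs-cong (suc m) lo zero    h = refl
  sumIncs-cong (suc m) lo (suc n) h = +-cong (sumIncs-cong m (suc lo) n λ us e → h _ (≡.cong suc e)) (sumIncs-cong (suc m) (suc lo) n h)

  sumIncs-*ˡ : ∀ m lo n x (F : List ℕ → Carrier) → sumIncs m lo n (λ us → x * F us) ≈ x * sumIncs m lo n F
  sumIncs-*ˡ zero    lo n       x F = refl
  sumIncs-*ˡ (suc m) lo zero    x F = sym (zeroʳ x)
  sumIncs-*ˡ (suc m) lo (suc n) x F = trans (+-cong (sumIncs-*ˡ m (suc lo) n x _) (sumIncs-*ˡ (suc m) (suc lo) n x F)) (sym (distribˡ x _ _))

  sumComps : ℕ → ℕ → (List ℕ → Carrier) → Carrier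
  sumComps zero    zero    F = F []
  sumComps zero    (suc r) F = 0#
  sumComps (suc f) zero    F = F []
  sumComps (suc f) (suc r) F = conv r (λ i j → sumComps f j (λ is → F (suc i ∷ is)))

  sumComps-cong : ∀ f r {F G : List ℕ → Carrier} → (∀ is → sumN is ≡ r → F is ≈ G is) → sumComps f r F ≈ sumComps f r G
  sumComps-cong zero    zero    h = h [] ≡.refl
  sumComps-cong zero    (suc r) h = refl
  sumComps-cong (suc f) zero    h = h [] ≡.refl
  sumComps-cong (suc f) (suc r) h = conv-cong r λ i j ij → sumComps-cong f j λ is s → h _ (≡.cong suc (≡.trans (≡.cong (i ℕ.+_) s) ij))

  sumComps-+ : ∀ f r (F G : List ℕ → Carrier) → sumComps f r (λ is → F is + G is) ≈ sumComps f r F + sumComps f r G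
  sumComps-+ zero    zero    F G = refl
  sumComps-+ zero    (suc r) F G = sym (+-identityˡ _)
  sumComps-+ (suc f) zero    F G = refl
  sumComps-+ (suc f) (suc r) F G = trans (conv-cong r λ i j _ → sumComps-+ f j _ _) (conv-+ r _ _)

  sumComps-*ˡ : ∀ f r x (F : List ℕ → Carrier) → sumComps f r (λ is → x * F is) ≈ x * sumComps f r F
  sumComps-*ˡ zero    zero    x F = refl
  sumComps-*ˡ zero    (suc r) x F = sym (zeroʳ x)
  sumComps-*ˡ (suc f) zero    x F = refl
  sumComps-*ˡ (suc f) (suc r) x F = trans (conv-cong r λ i j _ → sumComps-*ˡ f j x _) (conv-*ˡ r x _)

  sumComps-0 : ∀ f r → sumComps f r (λ _ → 0#) ≈ 0#
  sumComps-0 zero    zero    = refl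
  sumComps-0 zero    (suc r) = refl
  sumComps-0 (suc f) zero    = refl
  sumComps-0 (suc f) (suc r) = conv-zero r λ i j _ → sumComps-0 f j

module IncreasingSums {c ℓ} (R : CommutativeRing c ℓ)
  (inv : ℕ → CommutativeRing.Carrier R) (inv-inverse : Convolution.InvertsNats R inv)
  (g : ℕ → CommutativeRing.Carrier R) where

  open CommutativeRing R hiding (zero)
  open Convolution R
  open DividedPowers R inv inv-inverse
  open OrderedExponential R inv inv-inverse g
  open CompositionSums R public
  open Relation.Binary.Reasoning.Setoid setoid
  open Solver commutativeSemiring using (solve; _:=_; _:+_; _:*_)

  -- The counterpart of `desc` on the points lo + 1, ..., lo + n. The sums in `h` list the points
  -- from the smallest upwards, whereas the ordered exponential peels them off from the largest.
  asc : ℕ → ℕ → ℕ → (List ℕ → Carrier) → Carrier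
  asc lo zero    zero    G = G []
  asc lo zero    (suc r) G = 0#
  asc lo (suc n) r       G =
    conv r (λ i j → dp (g (suc lo)) i * asc (suc lo) n j (λ e → G (replicate i (suc lo) ++ e)))

  asc-cong : ∀ lo n r {G H : List ℕ → Carrier} → (∀ e → G e ≈ H e) → asc lo n r G ≈ asc lo n r H
  asc-cong lo zero    zero    h = h []
  asc-cong lo zero    (suc r) h = refl
  asc-cong lo (suc n) r       h = conv-cong r λ i j _ → *-congˡ (asc-cong (suc lo) n j λ e → h _)

  asc-zero : ∀ lo n G → asc lo n 0 G ≈ G []
  asc-zero lo zero    G = refl
  asc-zero lo (suc n) G = trans (*-identityˡ _) (asc-zero (suc lo) n G)

  -- The multiplicities of the lowest and the highest point are summed independently, so `conv-swap`
  -- can bring the highest one to the front.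
  asc-last : ∀ lo n r G →
             asc lo (suc n) r G ≈
             conv r (λ i j → dp (g (suc lo ℕ.+ n)) i * asc lo n j (λ e → G (e ++ replicate i (suc lo ℕ.+ n))))
  asc-last lo zero    r G = conv-cong r λ i j _ →
    *-cong (reflexive (≡.cong (λ u → dp (g (suc u)) i) (≡.sym (ℕₚ.+-identityʳ lo)))) (lem i j)
    where
    lem : ∀ i j → asc (suc lo) zero j (λ e → G (replicate i (suc lo) ++ e)) ≈
                  asc lo zero j (λ e → G (e ++ replicate i (suc lo ℕ.+ 0)))
    lem i zero    = reflexive (≡.cong G (≡.trans (++-identityʳ _) (≡.cong (λ u → replicate i (suc u)) (≡.sym (ℕₚ.+-identityʳ lo)))))
    lem i (suc j) = refl
  asc-last lo (suc n) r G = begin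
    conv r (λ i m → dp γ i * asc (suc lo) (suc n) m (λ e → G (replicate i (suc lo) ++ e)))
      ≈⟨ conv-cong r (λ i m _ → trans (*-congˡ (asc-last (suc lo) n m (λ e → G (replicate i (suc lo) ++ e)))) (sym (conv-*ˡ m (dp γ i) _))) ⟩
    conv r (λ i m → conv m (λ k l → dp γ i * (dp δ k * asc (suc lo) n l (λ e → G (replicate i (suc lo) ++ (e ++ replicate k v))))))
      ≈⟨ conv-swap r _ ⟩
    conv r (λ k m → conv m (λ i l → dp γ i * (dp δ k * asc (suc lo) n l (λ e → G (replicate i (suc lo) ++ (e ++ replicate k v))))))
      ≈⟨ conv-cong r (λ k m _ → trans (conv-cong m (λ i l _ → lem i k l)) (conv-*ˡ m (dp δ k) _)) ⟩
    conv r (λ k m → dp δ k * asc lo (suc n) m (λ e → G (e ++ replicate k v)))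
      ≈⟨ reflexive (≡.cong (λ u → conv r (λ k m → dp (g (suc u)) k * asc lo (suc n) m (λ e → G (e ++ replicate k (suc u)))))
           (≡.sym (ℕₚ.+-suc lo n))) ⟩
    conv r (λ k m → dp (g (suc lo ℕ.+ suc n)) k * asc lo (suc n) m (λ e → G (e ++ replicate k (suc lo ℕ.+ suc n)))) ∎
    where
    v = suc (suc lo) ℕ.+ n
    γ = g (suc lo)
    δ = g v
    lem : ∀ i k l → dp γ i * (dp δ k * asc (suc lo) n l (λ e → G (replicate i (suc lo) ++ (e ++ replicate k v)))) ≈
                    dp δ k * (dp γ i * asc (suc lo) n l (λ e → G ((replicate i (suc lo) ++ e) ++ replicate k v)))
    lem i k l = trans
      (solve 3 (λ a b c → a :* (b :* c) := b :* (a :* c)) refl (dp γ i) (dp δ k) _)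
      (*-congˡ (*-congˡ (asc-cong (suc lo) n l λ e → reflexive (≡.cong G (≡.sym (++-assoc (replicate i (suc lo)) e _))))))

  asc≈desc : ∀ n r G → asc 0 n r G ≈ desc n r (λ e → G (reverse e))
  asc≈desc zero    zero    G = refl
  asc≈desc zero    (suc r) G = refl
  asc≈desc (suc n) r       G = begin
    asc 0 (suc n) r G
      ≈⟨ asc-last 0 n r G ⟩
    conv r (λ i j → dp (g (suc n)) i * asc 0 n j (λ e → G (e ++ replicate i (suc n))))
      ≈⟨ conv-cong r (λ i j _ → *-congˡ (trans (asc≈desc n j _) (desc-cong n j λ e _ → reflexive (≡.cong G (≡.sym (rev i e)))))) ⟩
    conv r (λ i j → dp (g (suc n)) i * desc n j (λ e → G (reverse (replicate i (suc n) ++ e)))) ∎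
    where
    rev : ∀ i e → reverse (replicate i (suc n) ++ e) ≡ reverse e ++ replicate i (suc n)
    rev i e = ≡.trans (reverse-++ (replicate i (suc n)) e) (≡.cong (reverse e ++_) (reverse-replicate i (suc n)))

  mass : List ℕ → List ℕ → Carrier
  mass []       us       = 1#
  mass (i ∷ is) []       = 1#
  mass (i ∷ is) (u ∷ us) = dp (g u) i * mass is us

  -- A composition together with strictly increasing points is the same as a multiplicity mᵤ ≥ 0 at
  -- every point u, listed by its support. The bound r ≤ f says that the fuel `f` suffices to reach
  -- all compositions.
  sumComps-asc : ∀ n lo f r G → r ℕ.≤ f →
                 sumComps f r (λ is → sumIncs (length is) lo n (λ us → mass is us * G (expand is us))) ≈
                 asc lo n r G
  sumComps-asc n       lo zero    zero    G l = trans (*-identityˡ _) (sym (asc-zero lo n G))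
  sumComps-asc n       lo (suc f) zero    G l = trans (*-identityˡ _) (sym (asc-zero lo n G))
  sumComps-asc zero    lo (suc f) (suc r) G l = conv-zero r λ i j _ → sumComps-0 f j
  sumComps-asc (suc n) lo (suc f) (suc r) G (ℕ.s≤s l) = begin
    conv r (λ i j → sumComps f j (λ is → A i is + B i is))
      -- `A` collects the terms in which lo + 1 occurs, with multiplicity i + 1; in `B` all points
      -- lie above lo + 1.
      ≈⟨ trans (conv-cong r λ i j _ → sumComps-+ f j (A i) (B i)) (conv-+ r (λ i j → sumComps f j (A i)) _) ⟩
    conv r (λ i j → sumComps f j (A i)) + conv r (λ i j → sumComps f j (B i))
      ≈⟨ +-cong (conv-cong r λ i j ij → first i j (ℕₚ.≤-trans (≡.subst (j ℕ.≤_) ij (ℕₚ.m≤n+m j i)) l))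
                (sumComps-asc n (suc lo) (suc f) (suc r) G (ℕ.s≤s l)) ⟩
    conv r (λ i j → dp γ (suc i) * asc (suc lo) n j (λ e → G (replicate (suc i) (suc lo) ++ e))) + asc (suc lo) n (suc r) G
      ≈⟨ +-comm _ _ ⟩
    asc (suc lo) n (suc r) G + conv r (λ i j → dp γ (suc i) * asc (suc lo) n j (λ e → G (replicate (suc i) (suc lo) ++ e)))
      ≈⟨ +-congʳ (*-identityˡ _) ⟨
    asc lo (suc n) (suc r) G ∎
    where
    γ = g (suc lo)
    A B : ℕ → List ℕ → Carrier
    A i is = sumIncs (length is) (suc lo) n (λ us → dp γ (suc i) * mass is us * G (replicate (suc i) (suc lo) ++ expand is us))
    B i is = sumIncs (suc (length is)) (suc lo) n (λ us → mass (suc i ∷ is) us * G (expand (suc i ∷ is) us))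
    first : ∀ i j → j ℕ.≤ f → sumComps f j (A i) ≈ dp γ (suc i) * asc (suc lo) n j (λ e → G (replicate (suc i) (suc lo) ++ e))
    first i j jf = begin
      sumComps f j (A i)
        ≈⟨ sumComps-cong f j (λ is _ → trans
             (sumIncs-cong (length is) (suc lo) n (λ us _ → *-assoc (dp γ (suc i)) (mass is us) _))
             (sumIncs-*ˡ (length is) (suc lo) n (dp γ (suc i)) _)) ⟩
      sumComps f j (λ is → dp γ (suc i) * sumIncs (length is) (suc lo) n (λ us → mass is us * G (replicate (suc i) (suc lo) ++ expand is us)))
        ≈⟨ sumComps-*ˡ f j (dp γ (suc i)) _ ⟩
      dp γ (suc i) * sumComps f j (λ is → sumIncs (length is) (suc lo) n (λ us → mass is us * G (replicate (suc i) (suc lo) ++ expand is us)))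
        ≈⟨ *-congˡ (sumComps-asc n (suc lo) f j (λ e → G (replicate (suc i) (suc lo) ++ e)) jf) ⟩
      dp γ (suc i) * asc (suc lo) n j (λ e → G (replicate (suc i) (suc lo) ++ e)) ∎

-- Formal power series and their constants

module PowerSeries {c ℓ} (R : CommutativeRing c ℓ) where
  open CommutativeRing R hiding (zero)
  open Convolution R
  open Relation.Binary.Reasoning.Setoid setoid

  Series : Set c
  Series = ℕ → Carrier

  constant : Carrier → Series
  constant x zero    = x
  constant x (suc _) = 0#

  infixl 7 _⊛_
  _⊛_ : Series → Series → Series
  (s ⊛ t) k = conv k (λ i j → s i * t j)

  constant-⊛ : ∀ x s k → (constant x ⊛ s) k ≈ x * s k
  constant-⊛ x s zero    = refl
  constant-⊛ x s (suc k) = trans (+-congˡ (conv-zero k λ _ _ _ → zeroˡ _)) (+-identityʳ _)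

  ⊛-comm : ∀ s t k → (s ⊛ t) k ≈ (t ⊛ s) k
  ⊛-comm s t k = trans (conv-comm k _) (conv-cong k λ i j _ → *-comm (s j) (t i))

  ⊛-constant : ∀ s x k → (s ⊛ constant x) k ≈ s k * x
  ⊛-constant s x k = trans (⊛-comm s _ k) (trans (constant-⊛ x s k) (*-comm x (s k)))

  ⊛-assoc : ∀ s t u k → ((s ⊛ t) ⊛ u) k ≈ (s ⊛ (t ⊛ u)) k
  ⊛-assoc s t u k = begin
    conv k (λ m l → conv m (λ i j → s i * t j) * u l)
      ≈⟨ conv-cong k (λ m l _ → conv-*ʳ m (u l) _) ⟨
    conv k (λ m l → conv m (λ i j → s i * t j * u l))
      ≈⟨ conv-assoc k (λ i j l → s i * t j * u l) ⟩
    conv k (λ i m → conv m (λ j l → s i * t j * u l))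
      ≈⟨ conv-cong k (λ i m _ → trans (conv-cong m λ j l _ → *-assoc (s i) (t j) (u l)) (conv-*ˡ m (s i) _)) ⟩
    conv k (λ i m → s i * conv m (λ j l → t j * u l)) ∎

  ⊛-distribˡ : ∀ s t u k → (s ⊛ (λ k → t k + u k)) k ≈ (s ⊛ t) k + (s ⊛ u) k
  ⊛-distribˡ s t u k = trans (conv-cong k λ i j _ → distribˡ (s i) (t j) (u j)) (conv-+ k _ _)

  ⊛-distribʳ : ∀ s t u k → ((λ k → t k + u k) ⊛ s) k ≈ (t ⊛ s) k + (u ⊛ s) k
  ⊛-distribʳ s t u k = trans (conv-cong k λ i j _ → distribʳ (s j) (t i) (u i)) (conv-+ k _ _)

  seriesRing : CommutativeRing c ℓ
  seriesRing = record
    { Carrier = Series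
    ; _≈_ = λ s t → ∀ k → s k ≈ t k
    ; _+_ = λ s t k → s k + t k
    ; _*_ = _⊛_
    ; -_  = λ s k → - s k
    ; 0#  = λ _ → 0#
    ; 1#  = constant 1#
    ; isCommutativeRing = record
      { isRing = record
        { +-isAbelianGroup = record
          { isGroup = record
            { isMonoid = record
              { isSemigroup = record
                { isMagma = record
                  { isEquivalence = record
                    { refl = λ k → refl ; sym = λ e k → sym (e k) ; trans = λ e f k → trans (e k) (f k) }
                  ; ∙-cong = λ e f k → +-cong (e k) (f k) }
                ; assoc = λ s t u k → +-assoc (s k) (t k) (u k) }
              ; identity = (λ s k → +-identityˡ (s k)) , (λ s k → +-identityʳ (s k)) }
            ; inverse = (λ s k → -‿inverseˡ (s k)) , (λ s k → -‿inverseʳ (s k))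
            ; ⁻¹-cong = λ e k → -‿cong (e k) }
          ; comm = λ s t k → +-comm (s k) (t k) }
        ; *-cong = λ e f k → conv-cong k λ i j _ → *-cong (e i) (f j)
        ; *-assoc = ⊛-assoc
        ; *-identity = (λ s k → trans (constant-⊛ 1# s k) (*-identityˡ (s k)))
                     , (λ s k → trans (⊛-constant s 1# k) (*-identityʳ (s k)))
        ; distrib = ⊛-distribˡ , ⊛-distribʳ }
      ; *-comm = ⊛-comm } }

module PowerSeriesDividedPowers {c ℓ} (R : CommutativeRing c ℓ)
  (inv : ℕ → CommutativeRing.Carrier R) (inv-inverse : Convolution.InvertsNats R inv) where

  open CommutativeRing R hiding (zero)
  open Convolution R
  open PowerSeries R
  module S = CommutativeRing seriesRing
  module SC = Convolution seriesRing
  open DividedPowers R inv inv-inverse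

  constant-cong : ∀ {x y} → x ≈ y → constant x S.≈ constant y
  constant-cong e zero    = e
  constant-cong e (suc k) = refl

  constant-* : ∀ x y → constant x S.* constant y S.≈ constant (x * y)
  constant-* x y k = trans (constant-⊛ x (constant y) k) (lem k)
    where
    lem : ∀ k → x * constant y k ≈ constant (x * y) k
    lem zero    = refl
    lem (suc k) = zeroʳ x

  nat-constant : ∀ n → SC.nat n S.≈ constant (nat n)
  nat-constant zero    zero    = refl
  nat-constant zero    (suc k) = refl
  nat-constant (suc n) zero    = +-congˡ (nat-constant n zero)
  nat-constant (suc n) (suc k) = trans (+-identityˡ _) (nat-constant n (suc k))

  invˢ : ℕ → Series
  invˢ n = constant (inv n)

  invˢ-inverse : ∀ n → SC.nat (suc n) S.* invˢ n S.≈ S.1#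
  invˢ-inverse n = S.trans (S.*-congʳ {x = invˢ n} (nat-constant (suc n)))
    (S.trans (constant-* (nat (suc n)) (inv n)) (constant-cong (inv-inverse n)))

  module SD = DividedPowers seriesRing invˢ invˢ-inverse

  dp-constant : ∀ x n → SD.dp (constant x) n S.≈ constant (dp x n)
  dp-constant x zero    = S.refl
  dp-constant x (suc n) = S.trans
    (S.*-congˡ {x = invˢ n} (S.trans (S.*-congˡ {x = constant x} (dp-constant x n)) (constant-* x (dp x n))))
    (constant-* (inv n) (x * dp x n))

  -- Only the masses gᵤ involve q. The gaps are integers, so their exponential can be computed in ℚ
  -- and then regarded as a constant series.
  ex-diffs-constant : ∀ e a → SD.ex (SC.diffs e) a S.≈ constant (ex (diffs e) a)
  ex-diffs-constant []      a       = S.refl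
  ex-diffs-constant (x ∷ e) []      = S.refl
  ex-diffs-constant (x ∷ e) (n ∷ a) = S.trans
    (S.*-cong (S.trans (SD.dp-cong n difference) (dp-constant _ n)) (ex-diffs-constant e a))
    (constant-* _ _)
    where
    difference : SC.nat x S.- SC.nat (headOr0 e) S.≈ constant (nat x - nat (headOr0 e))
    difference zero    = +-cong (nat-constant x 0) (-‿cong (nat-constant (headOr0 e) 0))
    difference (suc k) = trans (+-cong (nat-constant x (suc k)) (-‿cong (nat-constant (headOr0 e) (suc k)))) (-‿inverseʳ 0#)

  conv-coeff : ∀ n F k → SC.conv n F k ≈ conv n (λ i j → F i j k)
  conv-coeff zero    F k = refl
  conv-coeff (suc n) F k = +-congˡ (conv-coeff n _ k)

open import Defs using (nQ; invFact; sumQ; prodQ; atQ; atN; decAt; one₁; mul₁; pow₁; geom; incs; Hcoef; monos; coefLinProd; substLin; compsF; blockForms; hcoef; gshForms; gshcoef; fromWord; block; 𝓘¹; unitI; _·I_; 𝔤ˢʰ; gBasis; Ser; oneS; mulS; _≈S_)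
open import Data.Nat using (_!; _∸_; _<ᵇ_; _≡ᵇ_)
open import Data.Nat.Properties using (_!≢0)
import Data.Integer as ℤ
import Data.Integer.Properties as ℤₚ
open import Data.Rational as ℚ using (ℚ; 0ℚ; 1ℚ; _/_; _+_; _*_; _-_)
open import Data.Rational.Properties as ℚₚ using (+-*-commutativeRing)
import Data.Rational.Unnormalised as ℚᵘ
import Data.Rational.Unnormalised.Properties as ℚᵘₚ
open import Relation.Binary.PropositionalEquality using (cong; cong₂; sym; trans; refl; module ≡-Reasoning)
open import Data.Bool using (T)
open import Data.List using (concatMap; upTo; applyUpTo)
open import Data.List.Properties using (length-map; length-reverse; map-upTo; map-++; map-∘; map-replicate; applyUpTo-∷ʳ; map-applyUpTo; map-concatMap; length-applyUpTo; reverse-involutive)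
open import Function using (_∘_)
open import Data.Unit using (tt)
open import Relation.Nullary using (contradiction)
import Algebra.Properties.CommutativeSemigroup
open import Data.Product using (_×_)

-- Coefficients of g_sh

module Qc = Convolution +-*-commutativeRing

-- `nQ` normalises its fraction and does not compute for a variable `n`; among unnormalised
-- rationals the equation becomes one between integers.
nQ-suc : ∀ n → nQ (suc n) ≡ 1ℚ ℚ.+ nQ n
nQ-suc n = ℚₚ.toℚᵘ-injective (begin
  ℚ.toℚᵘ (nQ (suc n))              ≈⟨ ℚₚ.toℚᵘ-fromℚᵘ (ℚᵘ.mkℚᵘ (ℤ.+ suc n) 0) ⟩
  ℚᵘ.mkℚᵘ (ℤ.+ suc n) 0            ≈⟨ ℚᵘ.*≡* (≡.cong (λ m → ℤ.+ m ℤ.* ℤ.+ 1) (≡.cong suc (≡.sym (≡.trans (≡.cong (ℕ._+ 0) (ℕₚ.*-identityʳ n)) (ℕₚ.+-identityʳ n))))) ⟩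
  ℚᵘ.mkℚᵘ (ℤ.+ suc (n ℕ.* 1 ℕ.+ 0)) 0 ≈⟨ ℚᵘ.*≡* (≡.cong (ℤ._* ℤ.+ 1) lem) ⟩
  ℚᵘ.mkℚᵘ (ℤ.+ 1) 0 ℚᵘ.+ ℚᵘ.mkℚᵘ (ℤ.+ n) 0
    ≈⟨ ℚᵘₚ.+-congʳ (ℚᵘ.mkℚᵘ (ℤ.+ 1) 0) (ℚₚ.toℚᵘ-fromℚᵘ (ℚᵘ.mkℚᵘ (ℤ.+ n) 0)) ⟨
  ℚᵘ.mkℚᵘ (ℤ.+ 1) 0 ℚᵘ.+ ℚ.toℚᵘ (nQ n) ≈⟨ ℚₚ.toℚᵘ-homo-+ 1ℚ (nQ n) ⟨
  ℚ.toℚᵘ (1ℚ ℚ.+ nQ n) ∎)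
  where
  open ℚᵘₚ.≃-Reasoning
  lem : ℤ.+ suc (n ℕ.* 1 ℕ.+ 0) ≡ ℤ.+ 1 ℤ.* ℤ.+ 1 ℤ.+ ℤ.+ n ℤ.* ℤ.+ 1
  lem = ≡.cong (λ z → ℤ.+ 1 ℤ.+ z) {x = ℤ.+ (n ℕ.* 1 ℕ.+ 0)} {y = ℤ.+ n ℤ.* ℤ.+ 1}
    (≡.trans (≡.cong ℤ.+_ (ℕₚ.+-identityʳ (n ℕ.* 1))) (ℤₚ.pos-* n 1))

nQ-inverse : ∀ m .{{_ : ℕ.NonZero m}} → nQ m ℚ.* (ℤ.+ 1 / m) ≡ 1ℚ
nQ-inverse (suc m) = ℚₚ.toℚᵘ-injective (begin
  ℚ.toℚᵘ (nQ (suc m) ℚ.* (ℤ.+ 1 / suc m))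
    ≈⟨ ℚₚ.toℚᵘ-homo-* (nQ (suc m)) (ℤ.+ 1 / suc m) ⟩
  ℚ.toℚᵘ (nQ (suc m)) ℚᵘ.* ℚ.toℚᵘ (ℤ.+ 1 / suc m)
    ≈⟨ ℚᵘₚ.*-cong (ℚₚ.toℚᵘ-fromℚᵘ (ℚᵘ.mkℚᵘ (ℤ.+ suc m) 0)) (ℚₚ.toℚᵘ-fromℚᵘ (ℚᵘ.mkℚᵘ (ℤ.+ 1) m)) ⟩
  ℚᵘ.mkℚᵘ (ℤ.+ suc m) 0 ℚᵘ.* ℚᵘ.mkℚᵘ (ℤ.+ 1) m
    ≈⟨ ℚᵘ.*≡* (≡.trans (ℤₚ.*-identityʳ _) (≡.trans (ℤₚ.*-comm (ℤ.+ suc m) (ℤ.+ 1)) (≡.cong (λ k → ℤ.+ 1 ℤ.* ℤ.+ suc k) (≡.sym (ℕₚ.+-identityʳ m))))) ⟩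
  ℚᵘ.1ℚᵘ ∎)
  where open ℚᵘₚ.≃-Reasoning

nat≡nQ : ∀ n → Qc.nat n ≡ nQ n
nat≡nQ zero    = ≡.refl
nat≡nQ (suc n) = ≡.trans (≡.cong (1ℚ ℚ.+_) (nat≡nQ n)) (≡.sym (nQ-suc n))

open CommutativeRing +-*-commutativeRing using () renaming (commutativeSemiring to ℚ-semiring)
open Solver ℚ-semiring using (solve; _:=_; _:+_; _:*_)
open ≡-Reasoning

invℚ : ℕ → ℚ
invℚ n = ℤ.+ 1 / suc n

invℚ-inverse : ∀ n → Qc.nat (suc n) * invℚ n ≡ 1ℚ
invℚ-inverse n = trans (cong (_* invℚ n) (nat≡nQ (suc n))) (nQ-inverse (suc n))

open Qc using (nat; conv; diffs)
open DividedPowers +-*-commutativeRing invℚ invℚ-inverse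
open LinearSubstitution +-*-commutativeRing invℚ invℚ-inverse
open PowerSeries +-*-commutativeRing
open PowerSeriesDividedPowers +-*-commutativeRing invℚ invℚ-inverse
open CompositionSums +-*-commutativeRing

nat-* : ∀ m n → nat (m ℕ.* n) ≡ nat m * nat n
nat-* zero    n = sym (ℚₚ.*-zeroˡ (nat n))
nat-* (suc m) n = begin
  nat (n ℕ.+ m ℕ.* n)         ≡⟨ Qc.nat-+ n (m ℕ.* n) ⟩
  nat n + nat (m ℕ.* n)       ≡⟨ cong₂ _+_ (sym (ℚₚ.*-identityˡ (nat n))) (nat-* m n) ⟩
  1ℚ * nat n + nat m * nat n  ≡⟨ ℚₚ.*-distribʳ-+ (nat n) 1ℚ (nat m) ⟨
  (1ℚ + nat m) * nat n ∎

nQ-* : ∀ m n → nQ (m ℕ.* n) ≡ nQ m * nQ n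
nQ-* m n = trans (sym (nat≡nQ (m ℕ.* n))) (trans (nat-* m n) (cong₂ _*_ (nat≡nQ m) (nat≡nQ n)))

invFact-suc : ∀ n → invFact (suc n) ≡ invℚ n * invFact n
invFact-suc n = begin
  invFact (suc n)
    ≡⟨ ℚₚ.*-identityˡ _ ⟨
  1ℚ * invFact (suc n)
    -- The factor 1 is written as (n + 1)/(n + 1) · n!/n!, so that (n + 1) n! can cancel against
    -- 1/(n + 1)!.
    ≡⟨ cong (_* invFact (suc n)) (cong₂ _*_ (nQ-inverse (suc n)) (nQ-inverse (n !) {{n !≢0}})) ⟨
  (nQ (suc n) * invℚ n) * (nQ (n !) * invFact n) * invFact (suc n)
    ≡⟨ solve 5 (λ a b c d e → (a :* b) :* (c :* d) :* e := (a :* c) :* e :* (b :* d)) refl (nQ (suc n)) (invℚ n) (nQ (n !)) (invFact n) (invFact (suc n)) ⟩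
  nQ (suc n) * nQ (n !) * invFact (suc n) * (invℚ n * invFact n)
    ≡⟨ cong (λ q → q * invFact (suc n) * (invℚ n * invFact n)) (nQ-* (suc n) (n !)) ⟨
  nQ (suc n !) * invFact (suc n) * (invℚ n * invFact n)
    ≡⟨ cong (_* (invℚ n * invFact n)) (nQ-inverse (suc n !) {{suc n !≢0}}) ⟩
  1ℚ * (invℚ n * invFact n)
    ≡⟨ ℚₚ.*-identityˡ _ ⟩
  invℚ n * invFact n ∎

dp-nat : ∀ u a → dp (nat u) a ≡ nQ (u ℕ.^ a) * invFact a
dp-nat u zero    = refl
dp-nat u (suc a) = begin
  invℚ a * (nat u * dp (nat u) a)
    ≡⟨ cong (invℚ a *_) (cong₂ _*_ (nat≡nQ u) (dp-nat u a)) ⟩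
  invℚ a * (nQ u * (nQ (u ℕ.^ a) * invFact a))
    ≡⟨ solve 4 (λ i u p f → i :* (u :* (p :* f)) := (u :* p) :* (i :* f)) refl (invℚ a) (nQ u) (nQ (u ℕ.^ a)) (invFact a) ⟩
  nQ u * nQ (u ℕ.^ a) * (invℚ a * invFact a)
    ≡⟨ cong₂ _*_ (nQ-* u (u ℕ.^ a)) (invFact-suc a) ⟨
  nQ (u ℕ.^ suc a) * invFact (suc a) ∎

nats : List ℕ → List ℚ
nats = map nat

ex-nats : ∀ us a → prodQ (zipWithL (λ u a → nQ (u ℕ.^ a) * invFact a) us a) ≡ ex (nats us) a
ex-nats []       a       = refl
ex-nats (u ∷ us) []      = refl
ex-nats (u ∷ us) (n ∷ a) = cong₂ _*_ (sym (dp-nat u n)) (ex-nats us a)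

-- The list sums of the definitions as structural recursions

sumQ-applyUpTo-cong : ∀ n {f g : ℕ → ℚ} → (∀ i → f i ≡ g i) → sumQ (applyUpTo f n) ≡ sumQ (applyUpTo g n)
sumQ-applyUpTo-cong zero    h = refl
sumQ-applyUpTo-cong (suc n) h = cong₂ _+_ (h 0) (sumQ-applyUpTo-cong n λ i → h (suc i))

sumQ-applyUpTo-0 : ∀ n {f : ℕ → ℚ} → (∀ i → f i ≡ 0ℚ) → sumQ (applyUpTo f n) ≡ 0ℚ
sumQ-applyUpTo-0 zero    h = refl
sumQ-applyUpTo-0 (suc n) h = trans (cong₂ _+_ (h 0) (sumQ-applyUpTo-0 n λ i → h (suc i))) (ℚₚ.+-identityˡ 0ℚ)

sumQ-conv : ∀ k (F : ℕ → ℕ → ℚ) → sumQ (map (λ i → F i (k ∸ i)) (upTo (suc k))) ≡ conv k F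
sumQ-conv k F = trans (cong sumQ (map-upTo (λ i → F i (k ∸ i)) (suc k))) (go k F)
  where
  go : ∀ k (F : ℕ → ℕ → ℚ) → sumQ (applyUpTo (λ i → F i (k ∸ i)) (suc k)) ≡ conv k F
  go zero    F = ℚₚ.+-identityʳ _
  go (suc k) F = cong (F 0 (suc k) +_) (go k λ i j → F (suc i) j)

sumQ-++ : ∀ xs ys → sumQ (xs ++ ys) ≡ sumQ xs + sumQ ys
sumQ-++ []       ys = sym (ℚₚ.+-identityˡ _)
sumQ-++ (x ∷ xs) ys = trans (cong (x +_) (sumQ-++ xs ys)) (sym (ℚₚ.+-assoc x _ _))

sumQ-concatMap : ∀ {A : Set} (f : A → List ℚ) xs → sumQ (concatMap f xs) ≡ sumQ (map (λ x → sumQ (f x)) xs)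
sumQ-concatMap f []       = refl
sumQ-concatMap f (x ∷ xs) = trans (sumQ-++ (f x) _) (cong (sumQ (f x) +_) (sumQ-concatMap f xs))

sumQ-map-concatMap : ∀ {A B : Set} (F : B → ℚ) (f : A → List B) xs →
                     sumQ (map F (concatMap f xs)) ≡ sumQ (map (λ x → sumQ (map F (f x))) xs)
sumQ-map-concatMap F f xs = trans (cong sumQ (map-concatMap F f xs)) (sumQ-concatMap (map F ∘ f) xs)

mul₁≡⊛ : ∀ f g k → mul₁ f g k ≡ (f ⊛ g) k
mul₁≡⊛ f g k = sumQ-conv k (λ i j → f i * g j)

one₁≡1 : ∀ k → one₁ k ≡ S.1# k
one₁≡1 zero    = refl
one₁≡1 (suc k) = refl

sum-monos : ∀ m d (F : List ℕ → ℚ) → sumQ (map F (monos m d)) ≡ sumMonos m d F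
sum-monos zero    zero    F = ℚₚ.+-identityʳ _
sum-monos zero    (suc d) F = refl
sum-monos (suc m) d       F = begin
  sumQ (map F (concatMap (λ i → map (i ∷_) (monos m (d ∸ i))) (upTo (suc d))))
    ≡⟨ sumQ-map-concatMap F (λ i → map (i ∷_) (monos m (d ∸ i))) (upTo (suc d)) ⟩
  sumQ (map (λ i → sumQ (map F (map (i ∷_) (monos m (d ∸ i))))) (upTo (suc d)))
    ≡⟨ sumQ-conv d (λ i j → sumQ (map F (map (i ∷_) (monos m j)))) ⟩
  conv d (λ i j → sumQ (map F (map (i ∷_) (monos m j))))
    ≡⟨ Qc.conv-cong d (λ i j _ → trans (cong sumQ (sym (map-∘ (monos m j)))) (sum-monos m j _)) ⟩
  sumMonos (suc m) d F ∎

sum-compsF : ∀ f r (F : List ℕ → ℚ) → sumQ (map F (compsF f r)) ≡ sumComps f r F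
sum-compsF zero    zero    F = ℚₚ.+-identityʳ _
sum-compsF zero    (suc r) F = refl
sum-compsF (suc f) zero    F = ℚₚ.+-identityʳ _
sum-compsF (suc f) (suc r) F = begin
  sumQ (map F (concatMap (λ i → map (suc i ∷_) (compsF f (r ∸ i))) (upTo (suc r))))
    ≡⟨ sumQ-map-concatMap F (λ i → map (suc i ∷_) (compsF f (r ∸ i))) (upTo (suc r)) ⟩
  sumQ (map (λ i → sumQ (map F (map (suc i ∷_) (compsF f (r ∸ i))))) (upTo (suc r)))
    ≡⟨ sumQ-conv r (λ i j → sumQ (map F (map (suc i ∷_) (compsF f j)))) ⟩
  conv r (λ i j → sumQ (map F (map (suc i ∷_) (compsF f j))))
    ≡⟨ Qc.conv-cong r (λ i j _ → trans (cong sumQ (sym (map-∘ (compsF f j)))) (sum-compsF f j _)) ⟩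
  sumComps (suc f) (suc r) F ∎

sum-incs : ∀ m lo n k (F : List ℕ → ℚ) → lo ℕ.+ n ≡ k → sumQ (map F (incs m lo k)) ≡ sumIncs m lo n F
sum-incs zero    lo n k F e = ℚₚ.+-identityʳ _
sum-incs (suc m) lo n k F e = begin
  sumQ (map F (incs (suc m) lo k))
    ≡⟨ sumQ-map-concatMap F _ (upTo (k ∸ lo)) ⟩
  sumQ (map (λ i → sumQ (map F (map (suc (lo ℕ.+ i) ∷_) (incs m (suc (lo ℕ.+ i)) k)))) (upTo (k ∸ lo)))
    ≡⟨ cong sumQ (map-upTo _ (k ∸ lo)) ⟩
  sumQ (applyUpTo (λ i → K (lo ℕ.+ i)) (k ∸ lo))
    ≡⟨ cong (λ N → sumQ (applyUpTo (λ i → K (lo ℕ.+ i)) N)) (trans (cong (_∸ lo) (sym e)) (ℕₚ.m+n∸m≡n lo n)) ⟩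
  sumQ (applyUpTo (λ i → K (lo ℕ.+ i)) n)
    ≡⟨ go lo n e ⟩
  sumIncs (suc m) lo n F ∎
  where
  K : ℕ → ℚ
  K u = sumQ (map F (map (suc u ∷_) (incs m (suc u) k)))
  go : ∀ lo n → lo ℕ.+ n ≡ k → sumQ (applyUpTo (λ i → K (lo ℕ.+ i)) n) ≡ sumIncs (suc m) lo n F
  go lo zero    e = refl
  go lo (suc n) e = cong₂ _+_
    (trans (cong K (ℕₚ.+-identityʳ lo)) (trans (cong sumQ (sym (map-∘ (incs m (suc lo) k))))
      (sum-incs m (suc lo) n k _ (trans (sym (ℕₚ.+-suc lo n)) e))))
    (trans (sumQ-applyUpTo-cong n λ i → cong K (ℕₚ.+-suc lo i)) (go (suc lo) n (trans (sym (ℕₚ.+-suc lo n)) e)))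

mulBy-sumQ : ∀ L (F : Coeff) a →
         sumQ (map (λ p → if 0 <ᵇ atN a p then atQ L p * F (decAt a p) else 0ℚ) (upTo (length a))) ≡ mulBy L F a
mulBy-sumQ L F a = trans (cong sumQ (map-upTo _ (length a))) (go L F a)
  where
  go : ∀ L (F : Coeff) a →
       sumQ (applyUpTo (λ p → if 0 <ᵇ atN a p then atQ L p * F (decAt a p) else 0ℚ) (length a)) ≡ mulBy L F a
  go []      F a           = sumQ-applyUpTo-0 (length a) λ p → lem (0 <ᵇ atN a p) (F (decAt a p))
    where
    lem : ∀ b x → (if b then 0ℚ * x else 0ℚ) ≡ 0ℚ
    lem true  x = ℚₚ.*-zeroˡ x
    lem false x = refl
  go (l ∷ L) F []          = refl
  go (l ∷ L) F (zero  ∷ a) = trans (ℚₚ.+-identityˡ _) (go L _ a)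
  go (l ∷ L) F (suc x ∷ a) = cong (l * F (x ∷ a) +_) (go L _ a)

coefLinProd≡linProd : ∀ Ls a → coefLinProd Ls a ≡ linProd Ls a
coefLinProd≡linProd []       a = refl
coefLinProd≡linProd (L ∷ Ls) a = trans (mulBy-sumQ L (coefLinProd Ls) a)
  (mulBy-cong L a λ a′ _ _ → coefLinProd≡linProd Ls a′)

substLin≡sumMonos : ∀ f m Ls a k →
                    substLin f m Ls a k ≡ sumMonos m (sumN a) (λ b → f b k * linProd (powers b Ls) a)
substLin≡sumMonos f m Ls a k = trans (sum-monos m (sumN a) _)
  (sumMonos-cong m (sumN a) λ b _ → cong (f b k *_) (coefLinProd≡linProd (powers b Ls) a))

-- The linear forms of the two substitutions

blockForm : ∀ off c s →
            applyUpTo (λ p → if p <ᵇ off then 0ℚ else (if p <ᵇ (off ℕ.+ c) then 1ℚ else 0ℚ)) (off ℕ.+ (c ℕ.+ s)) ≡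
            replicate off 0ℚ ++ replicate c 1ℚ ++ replicate s 0ℚ
blockForm zero      zero    zero    = refl
blockForm zero      zero    (suc s) = cong (0ℚ ∷_) (blockForm zero zero s)
blockForm zero      (suc c) s       = cong (1ℚ ∷_) (blockForm zero c s)
blockForm (suc off) c       s       = cong (0ℚ ∷_) (blockForm off c s)

addMul-block : ∀ off c w xs →
               addMul (replicate (off ℕ.+ c) 0ℚ ++ xs) w (replicate off 0ℚ ++ replicate c 1ℚ ++ replicate (length xs) 0ℚ) ≡
               replicate off 0ℚ ++ replicate c w ++ xs
addMul-block zero      zero    w []       = refl
addMul-block zero      zero    w (x ∷ xs) = cong₂ _∷_ (trans (cong (x +_) (ℚₚ.*-zeroʳ w)) (ℚₚ.+-identityʳ x)) (addMul-block zero zero w xs)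
addMul-block zero      (suc c) w xs       = cong₂ _∷_ (trans (ℚₚ.+-identityˡ _) (ℚₚ.*-identityʳ w)) (addMul-block zero c w xs)
addMul-block (suc off) c       w xs       = cong₂ _∷_ (trans (ℚₚ.+-identityˡ _) (ℚₚ.*-zeroʳ w)) (addMul-block off c w xs)

length-expand : ∀ is us → length us ≡ length is → length (expand is us) ≡ sumN is
length-expand []       us       e = refl
length-expand (i ∷ is) (u ∷ us) e = trans (length-++ (replicate i u))
  (cong₂ ℕ._+_ (length-replicate i) (length-expand is us (ℕₚ.suc-injective e)))

length-blockForms : ∀ is off r → All (λ L → length L ≡ r) (blockForms is off r)
length-blockForms []       off r = []
length-blockForms (i ∷ is) off r = length-applyUpTo _ r ∷ length-blockForms is (off ℕ.+ i) r

count-blockForms : ∀ is off r → length (blockForms is off r) ≡ length is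
count-blockForms []       off r = refl
count-blockForms (i ∷ is) off r = cong suc (count-blockForms is (off ℕ.+ i) r)

lin-blockForms : ∀ is us off r → length us ≡ length is → off ℕ.+ sumN is ≡ r →
                 lin r (nats us) (blockForms is off r) ≡ replicate off 0ℚ ++ nats (expand is us)
lin-blockForms []       []       off r e refl = trans (cong (λ n → replicate n 0ℚ) (ℕₚ.+-identityʳ off)) (sym (++-identityʳ _))
lin-blockForms (i ∷ is) (u ∷ us) off r e refl = begin
  addMul (lin r (nats us) (blockForms is (off ℕ.+ i) r)) (nat u) (applyUpTo _ r)
    ≡⟨ cong₂ (λ v L → addMul v (nat u) L)
         (lin-blockForms is us (off ℕ.+ i) r (ℕₚ.suc-injective e) (ℕₚ.+-assoc off i (sumN is)))
         (trans (blockForm off i (sumN is)) (cong (λ n → replicate off 0ℚ ++ replicate i 1ℚ ++ replicate n 0ℚ) (sym len))) ⟩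
  addMul (replicate (off ℕ.+ i) 0ℚ ++ xs) (nat u) (replicate off 0ℚ ++ replicate i 1ℚ ++ replicate (length xs) 0ℚ)
    ≡⟨ addMul-block off i (nat u) xs ⟩
  replicate off 0ℚ ++ replicate i (nat u) ++ xs
    ≡⟨ cong (replicate off 0ℚ ++_) (trans (map-++ nat (replicate i u) (expand is us)) (cong (_++ xs) (map-replicate nat i u))) ⟨
  replicate off 0ℚ ++ nats (replicate i u ++ expand is us) ∎
  where
  xs = nats (expand is us)
  len : length xs ≡ sumN is
  len = trans (length-map nat (expand is us)) (length-expand is us (ℕₚ.suc-injective e))

δ : ℕ → ℕ → ℚ
δ m n = if m ≡ᵇ n then 1ℚ else 0ℚ

-- Definitionally the l-th form of `gshForms r`, with the variables counted from 0.
gshForm : ℕ → ℕ → Form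
gshForm r l = applyUpTo (λ p → δ (p ℕ.+ l) r - δ (suc (p ℕ.+ l)) r) r

count-gshForms : ∀ r → length (gshForms r) ≡ r
count-gshForms r = length-applyUpTo _ r

length-gshForms : ∀ r → All (λ L → length L ≡ r) (gshForms r)
length-gshForms r = All.applyUpTo⁺₁ _ r λ _ → length-applyUpTo _ r

applyUpTo-cong : ∀ {A : Set} n {f g : ℕ → A} → (∀ i → f i ≡ g i) → applyUpTo f n ≡ applyUpTo g n
applyUpTo-cong zero    h = refl
applyUpTo-cong (suc n) h = cong₂ _∷_ (h 0) (applyUpTo-cong n λ i → h (suc i))

δ-+suc : ∀ r l → δ (r ℕ.+ suc l) r ≡ 0ℚ
δ-+suc zero    l = refl
δ-+suc (suc r) l = δ-+suc r l

-- Of the forms in r + 1 variables only the first, x_{r+1} - x_r, contains the last variable. The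
-- others are the forms in r variables, padded by a zero.
gshForm-suc : ∀ r l → gshForm (suc r) (suc (suc l)) ≡ gshForm r (suc l) ++ [ 0ℚ ]
gshForm-suc r l = begin
  applyUpTo f (suc r)
    ≡⟨ applyUpTo-∷ʳ f r ⟨
  applyUpTo f r ++ [ f r ]
    ≡⟨ cong₂ (λ xs x → xs ++ [ x ]) (applyUpTo-cong r eq)
         (trans (eq r) (cong₂ _-_ (δ-+suc r l) (trans (cong (λ m → δ m r) (sym (ℕₚ.+-suc r (suc l)))) (δ-+suc r (suc l))))) ⟩
  gshForm r (suc l) ++ [ 0ℚ ] ∎
  where
  f : ℕ → ℚ
  f p = δ (p ℕ.+ suc (suc l)) (suc r) - δ (suc (p ℕ.+ suc (suc l))) (suc r)
  eq : ∀ p → f p ≡ δ (p ℕ.+ suc l) r - δ (suc (p ℕ.+ suc l)) r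
  eq p = cong (λ m → δ m (suc r) - δ m r) (ℕₚ.+-suc p (suc l))

addMul-∷ʳ : ∀ v w L → length v ≡ length L → addMul (v ++ [ 0ℚ ]) w (L ++ [ 0ℚ ]) ≡ addMul v w L ++ [ 0ℚ ]
addMul-∷ʳ []      w []      e = cong [_] (trans (ℚₚ.+-identityˡ _) (ℚₚ.*-zeroʳ w))
addMul-∷ʳ (x ∷ v) w (l ∷ L) e = cong (x + w * l ∷_) (addMul-∷ʳ v w L (ℕₚ.suc-injective e))

lin-∷ʳ : ∀ r ws Ls → All (λ L → length L ≡ r) Ls →
         lin (suc r) ws (map (_++ [ 0ℚ ]) Ls) ≡ lin r ws Ls ++ [ 0ℚ ]
lin-∷ʳ r []       Ls       hs       = sym (replicate-∷ʳ r 0ℚ)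
lin-∷ʳ r (w ∷ ws) []       hs       = sym (replicate-∷ʳ r 0ℚ)
lin-∷ʳ r (w ∷ ws) (L ∷ Ls) (h ∷ hs) = trans
  (cong (λ v → addMul v w (L ++ [ 0ℚ ])) (lin-∷ʳ r ws Ls hs))
  (addMul-∷ʳ (lin r ws Ls) w L (trans (length-lin r ws Ls hs) (sym h)))

-- The added form is e (x_{r+1} - x_r): the new variable receives the gap e - 0, and -e turns the
-- previous last gap, which ended at 0, into one that ends at e.
addMul-diffs : ∀ x e → addMul (diffs x ++ [ 0ℚ ]) (nat e) (applyUpTo (λ p → δ p (length x) - δ (suc p) (length x)) (suc (length x))) ≡
               diffs (x ++ [ e ])
addMul-diffs []          e = cong [_] (trans (ℚₚ.+-identityˡ _) (trans (ℚₚ.*-identityʳ (nat e)) (sym (ℚₚ.+-identityʳ (nat e)))))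
addMul-diffs (x ∷ [])    e = cong₂ _∷_
  (cong₂ _+_ (ℚₚ.+-identityʳ (nat x)) (trans (sym (ℚₚ.neg-distribʳ-* (nat e) 1ℚ)) (cong ℚ.-_ (ℚₚ.*-identityʳ (nat e)))))
  (cong [_] (trans (ℚₚ.+-identityˡ _) (trans (ℚₚ.*-identityʳ (nat e)) (sym (ℚₚ.+-identityʳ (nat e))))))
addMul-diffs (x ∷ y ∷ z) e = cong₂ _∷_
  (trans (cong (nat x - nat y +_) (ℚₚ.*-zeroʳ (nat e))) (ℚₚ.+-identityʳ _))
  (addMul-diffs (y ∷ z) e)

-- Summation by parts: Σ e_l (x_{r+1-l} - x_{r-l}) = Σ (e_{r+1-p} - e_{r-p}) x_p, where x₀ = e₀ = 0.
lin-gshForms : ∀ es → lin (length es) (nats es) (gshForms (length es)) ≡ diffs (reverse es)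
lin-gshForms []       = refl
lin-gshForms (e ∷ es) = begin
  addMul (lin (suc r) (nats es) (applyUpTo (λ l → gshForm (suc r) (suc (suc l))) r)) (nat e) (gshForm (suc r) 1)
    ≡⟨ cong₂ (λ Ls L → addMul (lin (suc r) (nats es) Ls) (nat e) L)
         (trans (applyUpTo-cong r (gshForm-suc r)) (sym (map-applyUpTo (gshForm r ∘ suc) (_++ [ 0ℚ ]) r)))
         (applyUpTo-cong (suc r) λ p → cong (λ m → δ m (suc r) - δ (suc m) (suc r)) (ℕₚ.+-comm p 1)) ⟩
  addMul (lin (suc r) (nats es) (map (_++ [ 0ℚ ]) (gshForms r))) (nat e) (applyUpTo (λ p → δ p r - δ (suc p) r) (suc r))
    ≡⟨ cong (λ v → addMul v (nat e) (applyUpTo (λ p → δ p r - δ (suc p) r) (suc r)))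
         (trans (lin-∷ʳ r (nats es) (gshForms r) (length-gshForms r)) (cong (_++ [ 0ℚ ]) (lin-gshForms es))) ⟩
  addMul (diffs (reverse es) ++ [ 0ℚ ]) (nat e) (applyUpTo (λ p → δ p r - δ (suc p) r) (suc r))
    ≡⟨ cong (λ n → addMul (diffs (reverse es) ++ [ 0ℚ ]) (nat e) (applyUpTo (λ p → δ p n - δ (suc p) n) (suc n))) (length-reverse es) ⟨
  addMul (diffs (reverse es) ++ [ 0ℚ ]) (nat e) (applyUpTo (λ p → δ p (length (reverse es)) - δ (suc p) (length (reverse es))) (suc (length (reverse es))))
    ≡⟨ addMul-diffs (reverse es) e ⟩
  diffs (reverse es ++ [ e ])
    ≡⟨ cong diffs (unfold-reverse e es) ⟨
  diffs (reverse (e ∷ es)) ∎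
  where
  r = length es

-- Divided powers of q^u/(1 - q^u) and exchange of finite sums

module SC′ = Algebra.Properties.CommutativeSemigroup S.*-commutativeSemigroup
module SO = OrderedExponential seriesRing invˢ invˢ-inverse geom
module SI = IncreasingSums seriesRing invˢ invˢ-inverse geom

dp-geom : ∀ u n k → SD.dp (geom u) n k ≡ (constant (invFact n) ⊛ pow₁ (geom u) n) k
dp-geom u zero    k = sym (trans (constant-⊛ 1ℚ one₁ k) (trans (ℚₚ.*-identityˡ (one₁ k)) (one₁≡1 k)))
dp-geom u (suc n) k = begin
  (invˢ n ⊛ (γ ⊛ SD.dp γ n)) k
    ≡⟨ S.*-congˡ {invˢ n} {γ ⊛ SD.dp γ n} (S.*-congˡ {γ} {SD.dp γ n} (dp-geom u n)) k ⟩
  (invˢ n ⊛ (γ ⊛ (constant (invFact n) ⊛ p))) k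
    ≡⟨ S.*-congˡ {invˢ n} {γ ⊛ (constant (invFact n) ⊛ p)} (SC′.x∙yz≈y∙xz γ (constant (invFact n)) p) k ⟩
  (invˢ n ⊛ (constant (invFact n) ⊛ (γ ⊛ p))) k
    ≡⟨ S.*-assoc (invˢ n) (constant (invFact n)) (γ ⊛ p) k ⟨
  (invˢ n ⊛ constant (invFact n) ⊛ (γ ⊛ p)) k
    ≡⟨ S.*-cong {invˢ n ⊛ constant (invFact n)} {constant (invFact (suc n))} {γ ⊛ p} {mul₁ γ p}
         (λ j → trans (constant-* (invℚ n) (invFact n) j) (cong (λ x → constant x j) (sym (invFact-suc n))))
         (λ j → sym (mul₁≡⊛ γ p j)) k ⟩
  (constant (invFact (suc n)) ⊛ pow₁ γ (suc n)) k ∎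
  where
  γ = geom u
  p = pow₁ γ n

weight : List ℕ → List ℕ → Series
weight is us = foldr mul₁ one₁ (zipWithL (λ u n → pow₁ (geom u) n) us is)

mass-coeff : ∀ is us → length us ≡ length is → ∀ k → SI.mass is us k ≡ (constant (prodQ (map invFact is)) ⊛ weight is us) k
mass-coeff []       []       e k = sym (trans (constant-⊛ 1ℚ one₁ k) (trans (ℚₚ.*-identityˡ (one₁ k)) (one₁≡1 k)))
mass-coeff (i ∷ is) (u ∷ us) e k = begin
  (SD.dp (geom u) i ⊛ SI.mass is us) k
    ≡⟨ S.*-cong {SD.dp (geom u) i} {a ⊛ p} {SI.mass is us} {b ⊛ w} (dp-geom u i) (mass-coeff is us (ℕₚ.suc-injective e)) k ⟩
  ((a ⊛ p) ⊛ (b ⊛ w)) k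
    ≡⟨ SC′.interchange a p b w k ⟩
  ((a ⊛ b) ⊛ (p ⊛ w)) k
    ≡⟨ S.*-cong {a ⊛ b} {constant (prodQ (map invFact (i ∷ is)))} {p ⊛ w} {mul₁ p w}
         (constant-* (invFact i) (prodQ (map invFact is))) (λ j → sym (mul₁≡⊛ p w j)) k ⟩
  (constant (prodQ (map invFact (i ∷ is))) ⊛ weight (i ∷ is) (u ∷ us)) k ∎
  where
  a = constant (invFact i)
  b = constant (prodQ (map invFact is))
  p = pow₁ (geom u) i
  w = weight is us

sumIncs-coeff : ∀ m lo n F k → SI.sumIncs m lo n F k ≡ sumIncs m lo n (λ us → F us k)
sumIncs-coeff zero    lo n       F k = refl
sumIncs-coeff (suc m) lo zero    F k = refl
sumIncs-coeff (suc m) lo (suc n) F k = cong₂ _+_ (sumIncs-coeff m (suc lo) n _ k) (sumIncs-coeff (suc m) (suc lo) n F k)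

sumComps-coeff : ∀ f r F k → SI.sumComps f r F k ≡ sumComps f r (λ is → F is k)
sumComps-coeff zero    zero    F k = refl
sumComps-coeff zero    (suc r) F k = refl
sumComps-coeff (suc f) zero    F k = refl
sumComps-coeff (suc f) (suc r) F k = trans (conv-coeff r _ k) (Qc.conv-cong r λ i j _ → sumComps-coeff f j _ k)

sumMonos-+ : ∀ m d (F G : List ℕ → ℚ) → sumMonos m d (λ b → F b + G b) ≡ sumMonos m d F + sumMonos m d G
sumMonos-+ zero    zero    F G = refl
sumMonos-+ zero    (suc d) F G = refl
sumMonos-+ (suc m) d       F G = trans (Qc.conv-cong d λ i j _ → sumMonos-+ m j _ _)
  (Qc.conv-+ d (λ i j → sumMonos m j (λ b → F (i ∷ b))) (λ i j → sumMonos m j (λ b → G (i ∷ b))))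

sumMonos-0 : ∀ m d → sumMonos m d (λ _ → 0ℚ) ≡ 0ℚ
sumMonos-0 zero    zero    = refl
sumMonos-0 zero    (suc d) = refl
sumMonos-0 (suc m) d       = Qc.conv-zero d λ i j _ → sumMonos-0 m j

sumMonos-conv : ∀ m d n (F : ℕ → ℕ → List ℕ → ℚ) →
                sumMonos m d (λ b → conv n (λ i j → F i j b)) ≡ conv n (λ i j → sumMonos m d (F i j))
sumMonos-conv m d zero    F = refl
sumMonos-conv m d (suc n) F = trans (sumMonos-+ m d (F 0 (suc n)) (λ b → conv n (λ i j → F (suc i) j b)))
  (cong (sumMonos m d (F 0 (suc n)) +_) (sumMonos-conv m d n (λ i j → F (suc i) j)))

sumMonos-sumIncs : ∀ m d m′ lo n (F : List ℕ → List ℕ → ℚ) →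
                   sumMonos m d (λ b → sumIncs m′ lo n (λ us → F us b)) ≡ sumIncs m′ lo n (λ us → sumMonos m d (F us))
sumMonos-sumIncs m d zero     lo n       F = refl
sumMonos-sumIncs m d (suc m′) lo zero    F = sumMonos-0 m d
sumMonos-sumIncs m d (suc m′) lo (suc n) F =
  trans (sumMonos-+ m d (λ b → sumIncs m′ (suc lo) n (λ us → F (suc lo ∷ us) b)) (λ b → sumIncs (suc m′) (suc lo) n (λ us → F us b)))
    (cong₂ _+_ (sumMonos-sumIncs m d m′ (suc lo) n (λ us → F (suc lo ∷ us))) (sumMonos-sumIncs m d (suc m′) (suc lo) n F))

sumMonos-sumComps : ∀ m d f r (F : List ℕ → List ℕ → ℚ) →
                    sumMonos m d (λ b → sumComps f r (λ is → F is b)) ≡ sumComps f r (λ is → sumMonos m d (F is))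
sumMonos-sumComps m d zero    zero    F = refl
sumMonos-sumComps m d zero    (suc r) F = sumMonos-0 m d
sumMonos-sumComps m d (suc f) zero    F = refl
sumMonos-sumComps m d (suc f) (suc r) F =
  trans (sumMonos-conv m d r (λ i j b → sumComps f j (λ is → F (suc i ∷ is) b)))
    (Qc.conv-cong r λ i j _ → sumMonos-sumComps m d f j (λ is → F (suc i ∷ is)))

-- Coefficients as weighted sums of exponentials

weightedIncs : List ℕ → ℕ → (List ℕ → ℚ) → ℚ
weightedIncs is k G = sumIncs (length is) 0 k (λ us → weight is us k * G us)

weightedIncs-sumMonos : ∀ m d is k (G : List ℕ → List ℕ → ℚ) (P : List ℕ → ℚ) →
  sumMonos m d (λ b → weightedIncs is k (λ us → G us b) * P b) ≡
  weightedIncs is k (λ us → sumMonos m d (λ b → G us b * P b))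
weightedIncs-sumMonos m d is k G P = begin
  sumMonos m d (λ b → weightedIncs is k (λ us → G us b) * P b)
    ≡⟨ sumMonos-cong m d (λ b _ → trans (ℚₚ.*-comm _ (P b)) (sym (sumIncs-*ˡ (length is) 0 k (P b) _))) ⟩
  sumMonos m d (λ b → sumIncs (length is) 0 k (λ us → P b * (weight is us k * G us b)))
    ≡⟨ sumMonos-sumIncs m d (length is) 0 k (λ us b → P b * (weight is us k * G us b)) ⟩
  sumIncs (length is) 0 k (λ us → sumMonos m d (λ b → P b * (weight is us k * G us b)))
    ≡⟨ sumIncs-cong (length is) 0 k (λ us _ → trans
         (sumMonos-cong m d λ b _ → solve 3 (λ p w g → p :* (w :* g) := w :* (g :* p)) refl (P b) (weight is us k) (G us b))
         (sumMonos-*ˡ m d (weight is us k) (λ b → G us b * P b))) ⟩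
  weightedIncs is k (λ us → sumMonos m d (λ b → G us b * P b)) ∎

-- The coefficients of h and of g_sh are both values of this linear functional, at different
-- exponentials. A substitution thus passes through it and changes only the exponential inside,
-- where `ex-lin` applies.
weightedComps : ℕ → ℕ → (List ℕ → ℚ) → ℚ
weightedComps r k G = sumComps r r (λ is → prodQ (map invFact is) * weightedIncs is k (λ us → G (expand is us)))

weightedComps-cong : ∀ r k {G H : List ℕ → ℚ} → (∀ e → length e ≡ r → G e ≡ H e) → weightedComps r k G ≡ weightedComps r k H
weightedComps-cong r k h = sumComps-cong r r λ is s → cong (prodQ (map invFact is) *_)
  (sumIncs-cong (length is) 0 k λ us l → cong (weight is us k *_) (h _ (trans (length-expand is us l) s)))

weightedComps-sumMonos : ∀ m d r k (G : List ℕ → List ℕ → ℚ) (P : List ℕ → ℚ) →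
  sumMonos m d (λ b → weightedComps r k (λ e → G e b) * P b) ≡
  weightedComps r k (λ e → sumMonos m d (λ b → G e b * P b))
weightedComps-sumMonos m d r k G P = begin
  sumMonos m d (λ b → weightedComps r k (λ e → G e b) * P b)
    ≡⟨ sumMonos-cong m d (λ b _ → trans (ℚₚ.*-comm _ (P b)) (sym (sumComps-*ˡ r r (P b) _))) ⟩
  sumMonos m d (λ b → sumComps r r (λ is → P b * (π is * I is b)))
    ≡⟨ sumMonos-sumComps m d r r (λ is b → P b * (π is * I is b)) ⟩
  sumComps r r (λ is → sumMonos m d (λ b → P b * (π is * I is b)))
    ≡⟨ sumComps-cong r r (λ is _ → trans
         (sumMonos-cong m d λ b _ → solve 3 (λ p w g → p :* (w :* g) := w :* (g :* p)) refl (P b) (π is) (I is b))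
         (trans (sumMonos-*ˡ m d (π is) (λ b → I is b * P b))
           (cong (π is *_) (weightedIncs-sumMonos m d is k (λ us → G (expand is us)) P)))) ⟩
  weightedComps r k (λ e → sumMonos m d (λ b → G e b * P b)) ∎
  where
  π : List ℕ → ℚ
  π is = prodQ (map invFact is)
  I : List ℕ → List ℕ → ℚ
  I is b = weightedIncs is k (λ us → G (expand is us) b)

Hcoef-weighted : ∀ is b k → Hcoef is b k ≡ weightedIncs is k (λ us → ex (nats us) b)
Hcoef-weighted is b k = trans
  (sum-incs (length is) 0 k k (λ us → prodQ (zipWithL (λ u a → nQ (u ℕ.^ a) * invFact a) us b) * weight is us k) refl)
  (sumIncs-cong (length is) 0 k λ us _ → trans (ℚₚ.*-comm _ (weight is us k)) (cong (weight is us k *_) (ex-nats us b)))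

hcoef-weighted : ∀ r b k → length b ≡ r → hcoef r b k ≡ weightedComps r k (λ e → ex (nats e) b)
hcoef-weighted r b k refl = trans (sum-compsF r r _) (sumComps-cong r r λ is s → cong (prodQ (map invFact is) *_) (begin
  _ ≡⟨ substLin≡sumMonos (Hcoef is) (length is) (blockForms is 0 r) b k ⟩
  sumMonos (length is) (sumN b) (λ c → Hcoef is c k * P is c)
    ≡⟨ sumMonos-cong (length is) (sumN b) (λ c _ → cong (_* P is c) (Hcoef-weighted is c k)) ⟩
  sumMonos (length is) (sumN b) (λ c → weightedIncs is k (λ us → ex (nats us) c) * P is c)
    ≡⟨ weightedIncs-sumMonos (length is) (sumN b) is k (λ us c → ex (nats us) c) (P is) ⟩
  weightedIncs is k (λ us → sumMonos (length is) (sumN b) (λ c → ex (nats us) c * P is c))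
    ≡⟨ sumIncs-cong (length is) 0 k (λ us l → cong (weight is us k *_) (subst-ex is s us l)) ⟩
  weightedIncs is k (λ us → ex (nats (expand is us)) b) ∎))
  where
  P : List ℕ → List ℕ → ℚ
  P is c = linProd (powers c (blockForms is 0 r)) b
  subst-ex : ∀ is → sumN is ≡ r → ∀ us → length us ≡ length is →
             sumMonos (length is) (sumN b) (λ c → ex (nats us) c * P is c) ≡ ex (nats (expand is us)) b
  subst-ex is s us l = begin
    sumMonos (length is) (sumN b) (λ c → ex (nats us) c * P is c)
      ≡⟨ cong (λ m → sumMonos m (sumN b) (λ c → ex (nats us) c * P is c)) (trans (sym l) (sym (length-map nat us))) ⟩
    sumMonos (length (nats us)) (sumN b) (λ c → ex (nats us) c * P is c)
      ≡⟨ ex-lin (nats us) (blockForms is 0 r) (sumN b) b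
           (trans (length-map nat us) (trans l (sym (count-blockForms is 0 r)))) (length-blockForms is 0 r) refl ⟩
    ex (lin r (nats us) (blockForms is 0 r)) b
      ≡⟨ cong (λ v → ex v b) (lin-blockForms is us 0 r l s) ⟩
    ex (nats (expand is us)) b ∎

gshcoef-weighted : ∀ a k → gshcoef (length a) a k ≡ weightedComps (length a) k (λ e → ex (diffs (reverse e)) a)
gshcoef-weighted a k = begin
  gshcoef r a k
    ≡⟨ substLin≡sumMonos (hcoef r) r (gshForms r) a k ⟩
  sumMonos r (sumN a) (λ b → hcoef r b k * P b)
    ≡⟨ sumMonos-cong r (sumN a) (λ b l → cong (_* P b) (hcoef-weighted r b k l)) ⟩
  sumMonos r (sumN a) (λ b → weightedComps r k (λ e → ex (nats e) b) * P b)
    ≡⟨ weightedComps-sumMonos r (sumN a) r k (λ e b → ex (nats e) b) P ⟩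
  weightedComps r k (λ e → sumMonos r (sumN a) (λ b → ex (nats e) b * P b))
    ≡⟨ weightedComps-cong r k subst-ex ⟩
  weightedComps r k (λ e → ex (diffs (reverse e)) a) ∎
  where
  r = length a
  P : List ℕ → ℚ
  P b = linProd (powers b (gshForms r)) a
  subst-ex : ∀ e → length e ≡ r → sumMonos r (sumN a) (λ b → ex (nats e) b * P b) ≡ ex (diffs (reverse e)) a
  subst-ex e l = begin
    sumMonos r (sumN a) (λ b → ex (nats e) b * P b)
      ≡⟨ cong (λ m → sumMonos m (sumN a) (λ b → ex (nats e) b * P b)) (trans (sym l) (sym (length-map nat e))) ⟩
    sumMonos (length (nats e)) (sumN a) (λ b → ex (nats e) b * P b)
      ≡⟨ ex-lin (nats e) (gshForms r) (sumN a) a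
           (trans (length-map nat e) (trans l (sym (count-gshForms r)))) (length-gshForms r) refl ⟩
    ex (lin r (nats e) (gshForms r)) a
      ≡⟨ cong (λ n → ex (lin n (nats e) (gshForms n)) a) l ⟨
    ex (lin (length e) (nats e) (gshForms (length e))) a
      ≡⟨ cong (λ v → ex v a) (lin-gshForms e) ⟩
    ex (diffs (reverse e)) a ∎

-- The factors 1/i! and the powers of `geom` merge into divided powers over ℚ[[q]]. The number `k`
-- has two roles: it bounds the points, and it is the q-degree read off at the end.
weightedComps-asc : ∀ r k (G : List ℕ → ℚ) → weightedComps r k G ≡ SI.asc 0 k r (λ e → constant (G e)) k
weightedComps-asc r k G = begin
  weightedComps r k G
    ≡⟨ sumComps-cong r r (λ is _ → trans (sym (sumIncs-*ˡ (length is) 0 k (prodQ (map invFact is)) _))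
         (sumIncs-cong (length is) 0 k (λ us l → sym (term is us l)))) ⟩
  sumComps r r (λ is → sumIncs (length is) 0 k (λ us → (SI.mass is us ⊛ constant (G (expand is us))) k))
    ≡⟨ sumComps-cong r r (λ is _ → sumIncs-coeff (length is) 0 k (λ us → SI.mass is us ⊛ constant (G (expand is us))) k) ⟨
  sumComps r r (λ is → SI.sumIncs (length is) 0 k (λ us → SI.mass is us ⊛ constant (G (expand is us))) k)
    ≡⟨ sumComps-coeff r r (λ is → SI.sumIncs (length is) 0 k (λ us → SI.mass is us ⊛ constant (G (expand is us)))) k ⟨
  SI.sumComps r r (λ is → SI.sumIncs (length is) 0 k (λ us → SI.mass is us ⊛ constant (G (expand is us)))) k
    ≡⟨ SI.sumComps-asc k 0 r r (λ e → constant (G e)) ℕₚ.≤-refl k ⟩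
  SI.asc 0 k r (λ e → constant (G e)) k ∎
  where
  term : ∀ is us → length us ≡ length is →
         (SI.mass is us ⊛ constant (G (expand is us))) k ≡ prodQ (map invFact is) * (weight is us k * G (expand is us))
  term is us l = begin
    (SI.mass is us ⊛ constant (G (expand is us))) k
      ≡⟨ ⊛-constant (SI.mass is us) (G (expand is us)) k ⟩
    SI.mass is us k * G (expand is us)
      ≡⟨ cong (_* G (expand is us)) (trans (mass-coeff is us l k) (constant-⊛ (prodQ (map invFact is)) (weight is us) k)) ⟩
    prodQ (map invFact is) * weight is us k * G (expand is us)
      ≡⟨ ℚₚ.*-assoc (prodQ (map invFact is)) (weight is us k) _ ⟩
    prodQ (map invFact is) * (weight is us k * G (expand is us)) ∎

gshcoef-Φ : ∀ a k → gshcoef (length a) a k ≡ SO.Φ k (toWord a) k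
gshcoef-Φ a k = begin
  gshcoef r a k
    ≡⟨ gshcoef-weighted a k ⟩
  weightedComps r k (λ e → ex (diffs (reverse e)) a)
    ≡⟨ weightedComps-asc r k (λ e → ex (diffs (reverse e)) a) ⟩
  SI.asc 0 k r (λ e → constant (ex (diffs (reverse e)) a)) k
    ≡⟨ SI.asc≈desc k r (λ e → constant (ex (diffs (reverse e)) a)) k ⟩
  SO.desc k r (λ e → constant (ex (diffs (reverse (reverse e))) a)) k
    -- The reversal caused by the substitution and the one from `asc≈desc` cancel.
    ≡⟨ SO.desc-cong k r (λ e _ j → trans (cong (λ x → constant (ex (diffs x) a) j) (reverse-involutive e)) (sym (ex-diffs-constant e a j))) k ⟩
  SO.desc k r (λ e → SD.ex (SC.diffs e) a) k
    ≡⟨ SO.desc-Φ k a k ⟩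
  SO.Φ k (toWord a) k ∎
  where
  r = length a

-- Stability of the ordered exponentials in the q-adic sense

VanishesUpTo : ℕ → Series → Set
VanishesUpTo n s = ∀ k → k ℕ.≤ n → s k ≡ 0ℚ

⊛-vanishes : ∀ n s t → VanishesUpTo n s → VanishesUpTo n (s ⊛ t)
⊛-vanishes n s t h k k≤n = Qc.conv-zero k λ { i j refl →
  trans (cong (_* t j) (h i (ℕₚ.≤-trans (ℕₚ.m≤m+n i j) k≤n))) (ℚₚ.*-zeroˡ (t j)) }

geom-vanishes : ∀ n → VanishesUpTo n (geom (suc n))
geom-vanishes n k k≤n = trans (cong sumQ (map-upTo (λ m → if (suc n ℕ.* suc m) ≡ᵇ k then 1ℚ else 0ℚ) k)) (sumQ-applyUpTo-0 k term)
  where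
  term : ∀ m → (if (suc n ℕ.* suc m) ≡ᵇ k then 1ℚ else 0ℚ) ≡ 0ℚ
  term m with (suc n ℕ.* suc m) ≡ᵇ k in eq
  ... | false = refl
  ... | true  = contradiction (≡.subst (ℕ._≤ n) (sym (ℕₚ.≡ᵇ⇒≡ _ k (≡.subst T (sym eq) tt))) k≤n)
                  (ℕₚ.<⇒≱ (ℕₚ.m≤m*n (suc n) (suc m)))

dp-vanishes : ∀ n γ i → VanishesUpTo n γ → VanishesUpTo n (SD.dp γ (suc i))
dp-vanishes n γ i h k k≤n = trans (constant-⊛ (invℚ i) (γ ⊛ SD.dp γ i) k)
  (trans (cong (invℚ i *_) (⊛-vanishes n γ (SD.dp γ i) h k k≤n)) (ℚₚ.*-zeroʳ (invℚ i)))

-- The new factor exp(e₀) is invisible to a word without a leading 0, and exp(g e₁), with g the mass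
-- at n + 1, differs from 1 only by terms containing g, whose q-valuation exceeds n.
Φ-suc : ∀ n a k → k ℕ.≤ n → SO.Φ (suc n) (toWord a) k ≡ SO.Φ n (toWord a) k
Φ-suc n a k k≤n = begin
  SO.Φ (suc n) (toWord a) k
    ≡⟨ SO.E-ones γ ψ a k ⟩
  ψ (toWord a) k + SO.convTail (length a) (λ i _ → SD.dp γ i ⊛ X i) k
    ≡⟨ cong₂ _+_ (SO.E-toWord (SC.nat 1) (SO.Φ n) a k) (tail-zero (length a)) ⟩
  SO.Φ n (toWord a) k + 0ℚ
    ≡⟨ ℚₚ.+-identityʳ _ ⟩
  SO.Φ n (toWord a) k ∎
  where
  open ShuffleCharacters seriesRing invˢ invˢ-inverse using (E; ∂^)
  γ = geom (suc n)
  ψ = E false (SC.nat 1) (SO.Φ n)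
  X : ℕ → Series
  X i = ∂^ true i ψ (toWord a)
  tail-zero : ∀ r → SO.convTail r (λ i _ → SD.dp γ i ⊛ X i) k ≡ 0ℚ
  tail-zero zero    = refl
  tail-zero (suc r) = trans (conv-coeff r (λ i _ → SD.dp γ (suc i) ⊛ X (suc i)) k)
    (Qc.conv-zero r λ i _ _ → ⊛-vanishes n (SD.dp γ (suc i)) (X (suc i)) (dp-vanishes n γ i (geom-vanishes n)) k k≤n)

Φ-stable : ∀ d k a → SO.Φ (d ℕ.+ k) (toWord a) k ≡ SO.Φ k (toWord a) k
Φ-stable zero    k a = refl
Φ-stable (suc d) k a = trans (Φ-suc (d ℕ.+ k) a k (ℕₚ.m≤n+m k d)) (Φ-stable d k a)

-- Multiplicativity

module SS = ShuffleCharacters seriesRing invˢ invˢ-inverse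

countZeros : List Bool → ℕ
countZeros []          = 0
countZeros (true  ∷ w) = countZeros w
countZeros (false ∷ w) = suc (countZeros w)

countZeros-toWord : ∀ a → countZeros (toWord a) ≡ sumN a
countZeros-toWord []       = refl
countZeros-toWord (k ∷ ks) = go k
  where
  go : ∀ k → countZeros (replicate k false ++ toWord ks) ≡ k ℕ.+ sumN ks
  go zero    = countZeros-toWord ks
  go (suc k) = cong suc (go k)

shuffle-countZeros : ∀ u v → All (λ s → countZeros s ≡ countZeros u ℕ.+ countZeros v) (shuffle u v)
shuffle-countZeros []      v       = refl ∷ []
shuffle-countZeros (a ∷ u) []      = sym (ℕₚ.+-identityʳ _) ∷ []
shuffle-countZeros (a ∷ u) (b ∷ v) = All.++⁺
  (All.map⁺ (All.map (left a) (shuffle-countZeros u (b ∷ v))))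
  (All.map⁺ (All.map (right b) (shuffle-countZeros (a ∷ u) v)))
  where
  left : ∀ a {s n} → countZeros s ≡ countZeros u ℕ.+ n → countZeros (a ∷ s) ≡ countZeros (a ∷ u) ℕ.+ n
  left true  e = e
  left false e = cong suc e
  right : ∀ b {s m} → countZeros s ≡ m ℕ.+ countZeros v → countZeros (b ∷ s) ≡ m ℕ.+ countZeros (b ∷ v)
  right true  e = e
  right false e = trans (cong suc e) (sym (ℕₚ.+-suc _ _))

-- The state of `block c` stands for a letter 1 and `c` zeros that have already been read.
toWord-block : ∀ c s → toWord (block c s) ≡ true ∷ (replicate c false ++ s)
toWord-block c []          = refl
toWord-block c (false ∷ s) = trans (toWord-block (suc c) s)
  (cong (true ∷_) (trans (cong (_++ s) (sym (replicate-∷ʳ c false))) (++-assoc (replicate c false) [ false ] s)))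
toWord-block c (true ∷ s)  = cong (λ w → true ∷ (replicate c false ++ w)) (toWord-block 0 s)

toWord-fromWord-toWord : ∀ a → toWord (fromWord (toWord a)) ≡ toWord a
toWord-fromWord-toWord []      = refl
toWord-fromWord-toWord (k ∷ a) = toWord-block 0 _

-- `fromWord` discards leading zeros, but there are none here: a shuffle takes its first letter from
-- one of the two words, so it is empty or starts with 1.
shuffle-toWord : ∀ a b → All (λ s → toWord (fromWord s) ≡ s) (shuffle (toWord a) (toWord b))
shuffle-toWord []      b       = toWord-fromWord-toWord b ∷ []
shuffle-toWord (k ∷ a) []      = toWord-block 0 _ ∷ []
shuffle-toWord (k ∷ a) (l ∷ b) = All.++⁺
  (All.map⁺ (All.universal (toWord-block 0) (shuffle (replicate k false ++ toWord a) (toWord (l ∷ b)))))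
  (All.map⁺ (All.universal (toWord-block 0) (shuffle (toWord (k ∷ a)) (replicate l false ++ toWord b))))

-- The q-adic limit of `Φ n` at `toWord a`, read off along the diagonal.
φ : List ℕ → Series
φ a k = SO.Φ k (toWord a) k

Φ-φ : ∀ a {k n} → k ℕ.≤ n → SO.Φ n (toWord a) k ≡ φ a k
Φ-φ a {k} {n} k≤n = trans (cong (λ m → SO.Φ m (toWord a) k) (sym (ℕₚ.m∸n+n≡m k≤n))) (Φ-stable (n ∸ k) k a)

sumL-coeff : ∀ (f : List Bool → Series) ws k → SS.sumL f ws k ≡ sumQ (map (λ w → f w k) ws)
sumL-coeff f []       k = refl
sumL-coeff f (w ∷ ws) k = cong (f w k +_) (sumL-coeff f ws k)

sumQ-congᴬ : ∀ {A : Set} {f g : A → ℚ} {xs} → All (λ x → f x ≡ g x) xs → sumQ (map f xs) ≡ sumQ (map g xs)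
sumQ-congᴬ []       = refl
sumQ-congᴬ (h ∷ hs) = cong₂ _+_ h (sumQ-congᴬ hs)

-- The coefficient of q^k in the product involves only coefficients of degree at most k, and for
-- these both limits may be replaced by the single character `Φ k`.
φ-⊛ : ∀ a b k → (φ a ⊛ φ b) k ≡ sumQ (map (λ s → φ (fromWord s) k) (shuffle (toWord a) (toWord b)))
φ-⊛ a b k = begin
  (φ a ⊛ φ b) k
    ≡⟨ Qc.conv-cong k (λ { i j refl → cong₂ _*_ (Φ-φ a (ℕₚ.m≤m+n i j)) (Φ-φ b (ℕₚ.m≤n+m j i)) }) ⟨
  (SO.Φ k (toWord a) ⊛ SO.Φ k (toWord b)) k
    ≡⟨ SO.Φ-isCharacter k (toWord a) (toWord b) k ⟨
  SS.sumL (SO.Φ k) (shuffle (toWord a) (toWord b)) k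
    ≡⟨ sumL-coeff (SO.Φ k) (shuffle (toWord a) (toWord b)) k ⟩
  sumQ (map (λ s → SO.Φ k s k) (shuffle (toWord a) (toWord b)))
    ≡⟨ sumQ-congᴬ (All.map (λ e → cong (λ w → SO.Φ k w k) (sym e)) (shuffle-toWord a b)) ⟩
  sumQ (map (λ s → φ (fromWord s) k) (shuffle (toWord a) (toWord b))) ∎

-- The grading by t and series in q and t

monomial : ℕ → ℚ → ℕ → ℚ
monomial n x j = if j ≡ᵇ n then x else 0ℚ

Φ-[] : ∀ n k → SO.Φ n [] k ≡ S.1# k
Φ-[] zero    k = refl
Φ-[] (suc n) k = trans (S.*-identityˡ (S.1# S.* SO.Φ n []) k) (trans (S.*-identityˡ (SO.Φ n []) k) (Φ-[] n k))

gBasis-φ : ∀ a k j → gBasis a k j ≡ monomial (sumN a) (φ a k) j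
gBasis-φ (x ∷ a) k j = cong (λ y → monomial (sumN (x ∷ a)) y j) (gshcoef-Φ (x ∷ a) k)
gBasis-φ []      k j = sym (trans (cong (λ y → monomial 0 y j) (Φ-[] k k)) (unit k j))
  where
  unit : ∀ k j → monomial 0 (S.1# k) j ≡ oneS k j
  unit zero    zero    = refl
  unit zero    (suc j) = refl
  unit (suc k) zero    = refl
  unit (suc k) (suc j) = refl

monomial-0 : ∀ n j → monomial n 0ℚ j ≡ 0ℚ
monomial-0 n j with j ≡ᵇ n
... | true  = refl
... | false = refl

monomial-*ˡ : ∀ n x y j → x * monomial n y j ≡ monomial n (x * y) j
monomial-*ˡ n x y j with j ≡ᵇ n
... | true  = refl
... | false = ℚₚ.*-zeroʳ x

monomial-conv : ∀ n k (F : ℕ → ℕ → ℚ) j → conv k (λ i i′ → monomial n (F i i′) j) ≡ monomial n (conv k F) j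
monomial-conv n k F j with j ≡ᵇ n
... | true  = refl
... | false = Qc.conv-0 k

monomial-* : ∀ m n x y j → conv j (λ l l′ → monomial m x l * monomial n y l′) ≡ monomial (m ℕ.+ n) (x * y) j
monomial-* zero    n x y zero    = monomial-*ˡ n x y zero
monomial-* zero    n x y (suc j) = trans
  (cong₂ _+_ (monomial-*ˡ n x y (suc j)) (Qc.conv-zero j λ l l′ _ → ℚₚ.*-zeroˡ (monomial n y l′)))
  (ℚₚ.+-identityʳ _)
monomial-* (suc m) n x y zero    = ℚₚ.*-zeroˡ (monomial n y zero)
monomial-* (suc m) n x y (suc j) = trans
  (cong₂ _+_ (ℚₚ.*-zeroˡ (monomial n y (suc j))) (monomial-* m n x y j)) (ℚₚ.+-identityˡ _)

infixl 7 _⊛₂_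
_⊛₂_ : Ser → Ser → Ser
(f ⊛₂ g) k j = conv k (λ i i′ → (f i ⊛ g i′) j)

mulS≡⊛₂ : ∀ f g → mulS f g ≈S (f ⊛₂ g)
mulS≡⊛₂ f g k j = begin
  mulS f g k j
    ≡⟨ sumQ-concatMap (λ i → map (λ l → f i l * g (k ∸ i) (j ∸ l)) (upTo (suc j))) (upTo (suc k)) ⟩
  sumQ (map (λ i → mul₁ (f i) (g (k ∸ i)) j) (upTo (suc k)))
    ≡⟨ sumQ-conv k (λ i i′ → mul₁ (f i) (g i′) j) ⟩
  conv k (λ i i′ → mul₁ (f i) (g i′) j)
    ≡⟨ Qc.conv-cong k (λ i i′ _ → mul₁≡⊛ (f i) (g i′) j) ⟩
  (f ⊛₂ g) k j ∎

conv-linear : ∀ n c (F G : ℕ → ℕ → ℚ) → conv n (λ i j → c * F i j + G i j) ≡ c * conv n F + conv n G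
conv-linear n c F G = trans (Qc.conv-+ n (λ i j → c * F i j) G) (cong (_+ conv n G) (Qc.conv-*ˡ n c F))

⊛₂-linearˡ : ∀ c f f′ g k j → ((λ k j → c * f k j + f′ k j) ⊛₂ g) k j ≡ c * (f ⊛₂ g) k j + (f′ ⊛₂ g) k j
⊛₂-linearˡ c f f′ g k j = trans
  (Qc.conv-cong k λ i i′ _ → trans
    (Qc.conv-cong j λ l l′ _ → solve 4 (λ c x y z → (c :* x :+ y) :* z := c :* (x :* z) :+ y :* z) refl c (f i l) (f′ i l) (g i′ l′))
    (conv-linear j c (λ l l′ → f i l * g i′ l′) (λ l l′ → f′ i l * g i′ l′)))
  (conv-linear k c (λ i i′ → (f i ⊛ g i′) j) (λ i i′ → (f′ i ⊛ g i′) j))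

⊛₂-linearʳ : ∀ c f g g′ k j → (f ⊛₂ (λ k j → c * g k j + g′ k j)) k j ≡ c * (f ⊛₂ g) k j + (f ⊛₂ g′) k j
⊛₂-linearʳ c f g g′ k j = trans
  (Qc.conv-cong k λ i i′ _ → trans
    (Qc.conv-cong j λ l l′ _ → solve 4 (λ c x y z → z :* (c :* x :+ y) := c :* (z :* x) :+ z :* y) refl c (g i′ l′) (g′ i′ l′) (f i l))
    (conv-linear j c (λ l l′ → f i l * g i′ l′) (λ l l′ → f i l * g′ i′ l′)))
  (conv-linear k c (λ i i′ → (f i ⊛ g i′) j) (λ i i′ → (f i ⊛ g′ i′) j))

⊛₂-zeroˡ : ∀ g k j → ((λ _ _ → 0ℚ) ⊛₂ g) k j ≡ 0ℚ
⊛₂-zeroˡ g k j = Qc.conv-zero k λ i i′ _ → Qc.conv-zero j λ l l′ _ → ℚₚ.*-zeroˡ (g i′ l′)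

⊛₂-zeroʳ : ∀ f k j → (f ⊛₂ (λ _ _ → 0ℚ)) k j ≡ 0ℚ
⊛₂-zeroʳ f k j = Qc.conv-zero k λ i i′ _ → Qc.conv-zero j λ l l′ _ → ℚₚ.*-zeroʳ (f i l)

-- Shuffling preserves the number of zeros, which is the exponent of t, so both sides are
-- concentrated in the one t-degree `sumN a ℕ.+ sumN b`. There the claim is `φ-⊛`.
gBasis-⊛₂ : ∀ a b k j → (gBasis a ⊛₂ gBasis b) k j ≡ sumQ (map (λ s → gBasis (fromWord s) k j) (shuffle (toWord a) (toWord b)))
gBasis-⊛₂ a b k j = begin
  (gBasis a ⊛₂ gBasis b) k j
    ≡⟨ Qc.conv-cong k (λ i i′ _ → trans
         (Qc.conv-cong j λ l l′ _ → cong₂ _*_ (gBasis-φ a i l) (gBasis-φ b i′ l′))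
         (monomial-* (sumN a) (sumN b) (φ a i) (φ b i′) j)) ⟩
  conv k (λ i i′ → monomial n (φ a i * φ b i′) j)
    ≡⟨ monomial-conv n k (λ i i′ → φ a i * φ b i′) j ⟩
  monomial n ((φ a ⊛ φ b) k) j
    ≡⟨ cong (λ x → monomial n x j) (φ-⊛ a b k) ⟩
  monomial n (sumQ (map (λ s → φ (fromWord s) k) ws)) j
    ≡⟨ monomial-sumQ (λ s → φ (fromWord s) k) ws ⟩
  sumQ (map (λ s → monomial n (φ (fromWord s) k) j) ws)
    ≡⟨ sumQ-congᴬ (All.zipWith (λ {s} (e , z) → sym (trans (gBasis-φ (fromWord s) k j)
         (cong (λ m → monomial m (φ (fromWord s) k) j) (degree s e z))))
         (shuffle-toWord a b , shuffle-countZeros (toWord a) (toWord b))) ⟩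
  sumQ (map (λ s → gBasis (fromWord s) k j) ws) ∎
  where
  n = sumN a ℕ.+ sumN b
  ws = shuffle (toWord a) (toWord b)
  monomial-sumQ : ∀ {A : Set} (f : A → ℚ) xs → monomial n (sumQ (map f xs)) j ≡ sumQ (map (λ x → monomial n (f x) j) xs)
  monomial-sumQ f []       = monomial-0 n j
  monomial-sumQ f (x ∷ xs) = trans (monomial-+ (f x) _) (cong (monomial n (f x) j +_) (monomial-sumQ f xs))
    where
    monomial-+ : ∀ x y → monomial n (x + y) j ≡ monomial n x j + monomial n y j
    monomial-+ x y with j ≡ᵇ n
    ... | true  = refl
    ... | false = refl
  degree : ∀ s → toWord (fromWord s) ≡ s → countZeros s ≡ countZeros (toWord a) ℕ.+ countZeros (toWord b) → sumN (fromWord s) ≡ n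
  degree s e z = begin
    sumN (fromWord s)                       ≡⟨ countZeros-toWord (fromWord s) ⟨
    countZeros (toWord (fromWord s))        ≡⟨ cong countZeros e ⟩
    countZeros s                            ≡⟨ z ⟩
    countZeros (toWord a) ℕ.+ countZeros (toWord b) ≡⟨ cong₂ ℕ._+_ (countZeros-toWord a) (countZeros-toWord b) ⟩
    n ∎

𝔤ˢʰ-++ : ∀ A B k j → 𝔤ˢʰ (A ++ B) k j ≡ 𝔤ˢʰ A k j + 𝔤ˢʰ B k j
𝔤ˢʰ-++ []            B k j = sym (ℚₚ.+-identityˡ _)
𝔤ˢʰ-++ ((c , w) ∷ A) B k j = trans (cong (c * gBasis w k j +_) (𝔤ˢʰ-++ A B k j)) (sym (ℚₚ.+-assoc (c * gBasis w k j) _ _))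

𝔤ˢʰ-scaled : ∀ c ws k j → 𝔤ˢʰ (map (λ s → (c , fromWord s)) ws) k j ≡ c * sumQ (map (λ s → gBasis (fromWord s) k j) ws)
𝔤ˢʰ-scaled c []       k j = sym (ℚₚ.*-zeroʳ c)
𝔤ˢʰ-scaled c (w ∷ ws) k j = trans (cong (c * gBasis (fromWord w) k j +_) (𝔤ˢʰ-scaled c ws k j))
  (sym (ℚₚ.*-distribˡ-+ c _ _))

𝔤ˢʰ-·I-basis : ∀ c w B k j → 𝔤ˢʰ (((c , w) ∷ []) ·I B) k j ≡ c * (gBasis w ⊛₂ 𝔤ˢʰ B) k j
𝔤ˢʰ-·I-basis c w []            k j = sym (trans (cong (c *_) (⊛₂-zeroʳ (gBasis w) k j)) (ℚₚ.*-zeroʳ c))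
𝔤ˢʰ-·I-basis c w ((d , v) ∷ B) k j = begin
  𝔤ˢʰ (((c , w) ∷ []) ·I ((d , v) ∷ B)) k j
    -- The outer `concatMap` over a single term leaves a trailing `[]`, which is moved into the
    -- second summand so that it becomes the product with `B`.
    ≡⟨ cong (λ X → 𝔤ˢʰ X k j) (++-assoc (map (λ s → (c * d , fromWord s)) ws) _ []) ⟩
  𝔤ˢʰ (map (λ s → (c * d , fromWord s)) ws ++ (((c , w) ∷ []) ·I B)) k j
    ≡⟨ 𝔤ˢʰ-++ (map (λ s → (c * d , fromWord s)) ws) (((c , w) ∷ []) ·I B) k j ⟩
  𝔤ˢʰ (map (λ s → (c * d , fromWord s)) ws) k j + 𝔤ˢʰ (((c , w) ∷ []) ·I B) k j
    ≡⟨ cong₂ _+_ (trans (𝔤ˢʰ-scaled (c * d) ws k j) (cong (c * d *_) (sym (gBasis-⊛₂ w v k j)))) (𝔤ˢʰ-·I-basis c w B k j) ⟩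
  c * d * (gBasis w ⊛₂ gBasis v) k j + c * (gBasis w ⊛₂ 𝔤ˢʰ B) k j
    ≡⟨ solve 4 (λ c d x y → c :* d :* x :+ c :* y := c :* (d :* x :+ y)) refl c d _ _ ⟩
  c * (d * (gBasis w ⊛₂ gBasis v) k j + (gBasis w ⊛₂ 𝔤ˢʰ B) k j)
    ≡⟨ cong (c *_) (⊛₂-linearʳ d (gBasis w) (gBasis v) (𝔤ˢʰ B) k j) ⟨
  c * (gBasis w ⊛₂ 𝔤ˢʰ ((d , v) ∷ B)) k j ∎
  where
  ws = shuffle (toWord w) (toWord v)

·I-∷ : ∀ c w A B → ((c , w) ∷ A) ·I B ≡ (((c , w) ∷ []) ·I B) ++ (A ·I B)
·I-∷ c w A B = cong (_++ (A ·I B)) (sym (++-identityʳ _))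

𝔤ˢʰ-·I : ∀ A B k j → 𝔤ˢʰ (A ·I B) k j ≡ (𝔤ˢʰ A ⊛₂ 𝔤ˢʰ B) k j
𝔤ˢʰ-·I []            B k j = sym (⊛₂-zeroˡ (𝔤ˢʰ B) k j)
𝔤ˢʰ-·I ((c , w) ∷ A) B k j = begin
  𝔤ˢʰ (((c , w) ∷ A) ·I B) k j
    ≡⟨ cong (λ X → 𝔤ˢʰ X k j) (·I-∷ c w A B) ⟩
  𝔤ˢʰ ((((c , w) ∷ []) ·I B) ++ (A ·I B)) k j
    ≡⟨ 𝔤ˢʰ-++ (((c , w) ∷ []) ·I B) (A ·I B) k j ⟩
  𝔤ˢʰ (((c , w) ∷ []) ·I B) k j + 𝔤ˢʰ (A ·I B) k j
    ≡⟨ cong₂ _+_ (𝔤ˢʰ-·I-basis c w B k j) (𝔤ˢʰ-·I A B k j) ⟩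
  c * (gBasis w ⊛₂ 𝔤ˢʰ B) k j + (𝔤ˢʰ A ⊛₂ 𝔤ˢʰ B) k j
    ≡⟨ ⊛₂-linearˡ c (gBasis w) (𝔤ˢʰ A) (𝔤ˢʰ B) k j ⟨
  (𝔤ˢʰ ((c , w) ∷ A) ⊛₂ 𝔤ˢʰ B) k j ∎

theorem4p3 : ((A B : 𝓘¹) → 𝔤ˢʰ (A ·I B) ≈S mulS (𝔤ˢʰ A) (𝔤ˢʰ B)) × (𝔤ˢʰ unitI ≈S oneS)
theorem4p3 = (λ A B k j → trans (𝔤ˢʰ-·I A B k j) (sym (mulS≡⊛₂ (𝔤ˢʰ A) (𝔤ˢʰ B) k j)))
           , (λ k j → trans (ℚₚ.+-identityʳ _) (ℚₚ.*-identityˡ (oneS k j)))
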